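{- Let $p>3$ be a prime. Suppose that the following statement holds for $p$: for every $n\ge1$ and every nonsingular $n\times n$ matrix $M$ over $\mathbb{F}_p$ with row vectors $a_1,\dots,a_n$, if $$\prod_{1\le i\le n}(1-g^{e_i})\cdot\prod_{1\le i\le n}(1-g^{a_i})=0\in\mathbb{F}_p[\mathbb{F}_p^n],$$ then also $$\prod_{1\le i\le n}(1-g^{e_i})\cdot\prod_{1\le i\le n}(1-g^{a_i})=0\in\mathbb{Z}[\mathbb{F}_p^n],$$ where $e_1,\dots,e_n$ are the standard basis vectors of $\mathbb{F}_p^n$. Then for every $n\ge 1$ and every nonsingular matrix $M\in M^{n\times n}(\mathbb{F}_p)$ there is a vector $x\in\mathbb{F}_p^n$ such that both $x$ and $Mx$ have only nonzero entries.
   Context: For a ring $R$, $R[\mathbb{F}_p^n]$ is the group ring of the additive group $\mathbb{F}_p^n$, written multiplicatively: $g^v$ denotes the group element $v\in\mathbb{F}_p^n$, so $g^vg^w=g^{v+w}$. -}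

module Defs where

open import Data.Nat as ℕ using (ℕ; zero; suc; NonZero)
open import Data.Nat.DivMod using (_mod_)
open import Data.Fin using (Fin; toℕ) renaming (zero to fzero; suc to fsuc)
open import Data.Fin.Properties using (all?) renaming (_≟_ to _≟ᶠ_)
open import Data.Integer as ℤ using (ℤ)
open import Data.List using (List; []; _∷_; map; concatMap; foldr; allFin)
open import Data.Vec.Functional using (Vector) renaming (_∷_ to _◂_)
open import Data.Product using (Σ; _×_)
open import Relation.Binary.PropositionalEquality using (_≡_)
open import Relation.Nullary using (does)
open import Data.Bool using (Bool; if_then_else_)

module Fp (p : ℕ) {{_ : NonZero p}} where

  F : Set
  F = Fin p

  0F 1F : F
  0F = 0 mod p
  1F = 1 mod p

  _+F_ _*F_ : F → F → F
  a +F b = (toℕ a ℕ.+ toℕ b) mod p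
  a *F b = (toℕ a ℕ.* toℕ b) mod p

  -F_ : F → F
  -F a = (p ℕ.∸ toℕ a) mod p

  ΣF : ∀ {n} → (Fin n → F) → F
  ΣF {zero} f = 0F
  ΣF {suc n} f = f fzero +F ΣF (λ i → f (fsuc i))

  -- vectors in F_p^n and n×n matrices over F_p (M i j = entry in row i, column j)
  Vec : ℕ → Set
  Vec n = Fin n → F

  Mat : ℕ → Set
  Mat n = Fin n → Fin n → F

  _·v_ : ∀ {n} → Mat n → Vec n → Vec n
  (M ·v x) i = ΣF (λ j → M i j *F x j)

  _·m_ : ∀ {n} → Mat n → Mat n → Mat n
  (M ·m N) i k = ΣF (λ j → M i j *F N j k)

  Id : ∀ {n} → Mat n
  Id i j = if does (i ≟ᶠ j) then 1F else 0F

  Nonsingular : ∀ {n} → Mat n → Set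
  Nonsingular {n} M = Σ (Mat n) λ N → (∀ i j → (M ·m N) i j ≡ Id i j) × (∀ i j → (N ·m M) i j ≡ Id i j)

  e : ∀ {n} → Fin n → Vec n
  e i j = if does (i ≟ᶠ j) then 1F else 0F

  row : ∀ {n} → Mat n → Fin n → Vec n
  row M i = M i

  _-v_ : ∀ {n} → Vec n → Vec n → Vec n
  (v -v w) i = v i +F (-F w i)

  0v : ∀ {n} → Vec n
  0v i = 0F

  allVecs : ∀ n → List (Vec n)
  allVecs zero = (λ ()) ∷ []
  allVecs (suc n) = concatMap (λ a → map (λ v → a ◂ v) (allVecs n)) (allFin p)

  _=v?_ : ∀ {n} → Vec n → Vec n → Bool
  v =v? w = does (all? (λ i → v i ≟ᶠ w i))

  -- The group ring A[F_p^n] for a commutative ring A (given by its operations):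
  -- an element is its coefficient function F_p^n → A.
  module GroupRing {A : Set} (0# 1# : A) (_+_ _*_ : A → A → A) (-_ : A → A) where

    GR : ℕ → Set
    GR n = Vec n → A

    g^ : ∀ {n} → Vec n → GR n
    g^ v w = if v =v? w then 1# else 0#

    1R : ∀ {n} → GR n
    1R = g^ 0v

    _-R_ : ∀ {n} → GR n → GR n → GR n
    (f -R h) w = f w + (- h w)

    _*R_ : ∀ {n} → GR n → GR n → GR n
    _*R_ {n} f h v = foldr (λ w acc → (f w * h (v -v w)) + acc) 0# (allVecs n)

    ∏R : ∀ {n} {m} → (Fin m → GR n) → GR n
    ∏R {m = zero} f = 1R
    ∏R {m = suc m} f = f fzero *R ∏R (λ i → f (fsuc i))

    IsZero : ∀ {n} → GR n → Set
    IsZero {n} f = ∀ v → f v ≡ 0#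

    expr : ∀ {n} → Mat n → GR n
    expr M = ∏R (λ i → 1R -R g^ (e i)) *R ∏R (λ i → 1R -R g^ (row M i))

  module GRFp = GroupRing 0F 1F _+F_ _*F_ -F_
  module GRℤ = GroupRing (ℤ.+ 0) (ℤ.+ 1) ℤ._+_ ℤ._*_ ℤ.-_

  Hypothesis : Set
  Hypothesis = ∀ n → 1 ℕ.≤ n → (M : Mat n) → Nonsingular M →
               GRFp.IsZero (GRFp.expr M) → GRℤ.IsZero (GRℤ.expr M)

{-# OPTIONS --safe #-}
module Submission where

-- The coefficient function of ∏ (1 − gᵛ) in ℤ[𝔽ₚⁿ] arises from δ₀ by applying the difference operators
-- Δᵥ φ (w) = φ (w) − φ (w − v), and the product vanishes over ℤ iff every x is orthogonal to some v.
-- Suppose M is a counterexample.  Some nowhere zero x₀ has a set I of nonzero entries of M x₀ and an index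
-- i₀ ∉ I such that (M x) i₀ = 0 for every nowhere zero x with M x nonzero on I.  Take p copies of M, add one
-- coordinate z with row z, and add z to the rows i ∉ I of each copy.  The new matrix is nonsingular and
-- (1, x₀, …, x₀) shows that its product is nonzero over ℤ.  But the row aᵢ₀ + z of each copy may be replaced
-- by z without changing the product, because the remaining factors are fixed by gᵃ for a = aᵢ₀; so the
-- product is divisible by (1 − gᶻ)ᵖ, which is 0 modulo p.

open import Defs
open import Algebra.Bundles using (CommutativeMonoid; CommutativeRing)
import Algebra.Properties.CommutativeSemigroup as CommutativeSemigroupProperties
import Algebra.Properties.Ring as RingProperties
open import Algebra.Structures using (IsCommutativeRing)
open import Data.Bool using (true; false; if_then_else_)
open import Data.Empty using (⊥; ⊥-elim)
open import Data.Fin as Fin using (Fin; toℕ; _↑ˡ_; _↑ʳ_; combine; remQuot)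
open import Data.Fin.Properties as Finₚ using (toℕ-injective; toℕ-fromℕ<; toℕ<n; any?; all?)
open import Data.Integer as ℤ using (ℤ; +_)
import Data.Integer.Properties as ℤₚ
open import Data.Integer.Divisibility.Signed as ℤ∣ using (divides)
open import Data.Integer.Tactic.RingSolver using (solve-∀)
open import Data.List using (List; []; _∷_; map; concatMap; foldr; allFin; tabulate; _++_)
open import Data.Nat as ℕ using (ℕ; zero; suc; NonZero; _<_; _≤_; z≤n; s≤s)
open import Data.Nat.Coprimality using (prime⇒coprime; coprime-Bézout)
open import Data.Nat.DivMod as DM using (_mod_; _%_)
open import Data.Nat.GCD using (module Bézout)
import Data.Nat.Divisibility as ℕ∣
open import Data.Nat.Primality using (Prime; euclidsLemma)
import Data.Nat.Properties as ℕₚ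
open import Data.Product using (Σ; _×_; _,_; proj₁; proj₂; ∃)
open import Data.Sum using (_⊎_; inj₁; inj₂)
open import Data.Vec.Functional using () renaming (_∷_ to _◂_)
open import Function using (_∘_; id; case_of_)
open import Relation.Binary.PropositionalEquality using (_≡_; _≢_; _≗_; refl; sym; trans; cong; cong₂; subst; isEquivalence; module ≡-Reasoning)
open import Relation.Nullary using (¬_; Dec; yes; no; does)
open import Relation.Nullary.Decidable using (dec-true; dec-false; map′; ¬?; _×-dec_; _→-dec_)

open ≡-Reasoning

-- A counterexample M contradicts nothing by itself: its own product already vanishes over ℤ. The
-- hypothesis has to be applied to another matrix, with a product that is nonzero over ℤ yet zero
-- modulo p. The copies of M share the single coordinate z, so each supplies one factor 1 - gᶻ, and
-- p of them suffice because (1 - gᶻ)ᵖ ≡ 1 - gᵖᶻ = 0. The replacement of aᵢ₀ + z by z is an identity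
-- over ℤ. Instead of characters with values in roots of unity, the proof uses the hyperplane
-- indicators w ↦ δ(x·w): up to a constant, their sum over all x is a nonzero multiple of δ₀, and
-- differences kill the constant. On each summand Δᵥ becomes the difference with step x·v of a
-- function on 𝔽ₚ, so products are compared one x at a time. Nonvanishing also rests on
-- characteristic zero: if a difference with nonzero step on 𝔽ₚ is a constant κ, then going once
-- around gives pκ = 0, so κ = 0. The pair x₀, i₀ comes from the longest initial segment of rows of
-- M that some nowhere zero x keeps nonzero; i₀ is the next row.

infixl 6 _−_
_−_ : ℤ → ℤ → ℤ
a − b = a ℤ.+ (ℤ.- b)

−-interchange : ∀ a b c d → (a ℤ.+ (ℤ.- b)) ℤ.+ (c ℤ.+ (ℤ.- d)) ≡ (a ℤ.+ c) ℤ.+ (ℤ.- (b ℤ.+ d))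
−-interchange = solve-∀

−-−-interchange : ∀ a b c d → (a ℤ.+ (ℤ.- b)) ℤ.+ (ℤ.- (c ℤ.+ (ℤ.- d))) ≡ (a ℤ.+ (ℤ.- c)) ℤ.+ (ℤ.- (b ℤ.+ (ℤ.- d)))
−-−-interchange = solve-∀

*-distribʳ-− : ∀ a b c → (a ℤ.+ (ℤ.- b)) ℤ.* c ≡ a ℤ.* c ℤ.+ (ℤ.- (b ℤ.* c))
*-distribʳ-− = solve-∀

−-self-difference : ∀ a b → b ≡ a ℤ.+ (ℤ.- (a ℤ.+ (ℤ.- b)))
−-self-difference = solve-∀

-- Finite sums of integers.

ΣL : {X : Set} → (X → ℤ) → List X → ℤ
ΣL k = foldr (λ w acc → k w ℤ.+ acc) (+ 0)

ΣL-cong : ∀ {X : Set} {k l : X → ℤ} xs → (∀ x → k x ≡ l x) → ΣL k xs ≡ ΣL l xs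
ΣL-cong [] h = refl
ΣL-cong (x ∷ xs) h = cong₂ ℤ._+_ (h x) (ΣL-cong xs h)

ΣL-zero : ∀ {X : Set} {k : X → ℤ} xs → (∀ x → k x ≡ + 0) → ΣL k xs ≡ + 0
ΣL-zero [] h = refl
ΣL-zero (x ∷ xs) h = cong₂ ℤ._+_ (h x) (ΣL-zero xs h)

ΣL-+ : ∀ {X : Set} (k l : X → ℤ) xs → ΣL (λ x → k x ℤ.+ l x) xs ≡ ΣL k xs ℤ.+ ΣL l xs
ΣL-+ k l [] = refl
ΣL-+ k l (x ∷ xs) = trans (cong₂ ℤ._+_ (refl {x = (k x ℤ.+ l x)}) (ΣL-+ k l xs)) (+-interchange (k x) (l x) (ΣL k xs) (ΣL l xs))
  where
    +-interchange : ∀ a b c d → (a ℤ.+ b) ℤ.+ (c ℤ.+ d) ≡ (a ℤ.+ c) ℤ.+ (b ℤ.+ d)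
    +-interchange = solve-∀

ΣL-− : ∀ {X : Set} (k l : X → ℤ) xs → ΣL (λ x → k x − l x) xs ≡ ΣL k xs − ΣL l xs
ΣL-− k l [] = refl
ΣL-− k l (x ∷ xs) = trans (cong₂ ℤ._+_ (refl {x = (k x − l x)}) (ΣL-− k l xs)) (−-interchange (k x) (l x) (ΣL k xs) (ΣL l xs))

ΣL-swap : ∀ {X Y : Set} (k : X → Y → ℤ) xs ys →
          ΣL (λ x → ΣL (k x) ys) xs ≡ ΣL (λ y → ΣL (λ x → k x y) xs) ys
ΣL-swap k [] ys = sym (ΣL-zero ys (λ _ → refl))
ΣL-swap k (x ∷ xs) ys = trans (cong₂ ℤ._+_ (refl {x = ΣL (k x) ys}) (ΣL-swap k xs ys))
  (sym (ΣL-+ (k x) (λ y → ΣL (λ x → k x y) xs) ys))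

ΣL-++ : ∀ {X : Set} (k : X → ℤ) xs ys → ΣL k (xs ++ ys) ≡ ΣL k xs ℤ.+ ΣL k ys
ΣL-++ k [] ys = sym (ℤₚ.+-identityˡ _)
ΣL-++ k (x ∷ xs) ys = trans (cong₂ ℤ._+_ (refl {x = k x}) (ΣL-++ k xs ys)) (sym (ℤₚ.+-assoc (k x) (ΣL k xs) (ΣL k ys)))

ΣL-map : ∀ {X Y : Set} (k : Y → ℤ) (f : X → Y) xs → ΣL k (map f xs) ≡ ΣL (k ∘ f) xs
ΣL-map k f [] = refl
ΣL-map k f (x ∷ xs) = cong₂ ℤ._+_ (refl {x = k (f x)}) (ΣL-map k f xs)

ΣL-concatMap : ∀ {X Y : Set} (k : Y → ℤ) (f : X → List Y) xs →
               ΣL k (concatMap f xs) ≡ ΣL (λ x → ΣL k (f x)) xs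
ΣL-concatMap k f [] = refl
ΣL-concatMap k f (x ∷ xs) = trans (ΣL-++ k (f x) (concatMap f xs)) (cong₂ ℤ._+_ (refl {x = ΣL k (f x)}) (ΣL-concatMap k f xs))

ΣL-tabulate-zero : ∀ {X : Set} {m} (k : X → ℤ) (f : Fin m → X) → (∀ i → k (f i) ≡ + 0) → ΣL k (tabulate f) ≡ + 0
ΣL-tabulate-zero {m = zero} k f h = refl
ΣL-tabulate-zero {m = suc m} k f h = cong₂ ℤ._+_ (h Fin.zero) (ΣL-tabulate-zero k (f ∘ Fin.suc) (h ∘ Fin.suc))

ΣL-tabulate-single : ∀ {X : Set} {m} (k : X → ℤ) (f : Fin m → X) i →
                     (∀ j → j ≢ i → k (f j) ≡ + 0) → ΣL k (tabulate f) ≡ k (f i)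
ΣL-tabulate-single k f Fin.zero h =
  trans (cong₂ ℤ._+_ (refl {x = k (f Fin.zero)}) (ΣL-tabulate-zero k (f ∘ Fin.suc) (λ j → h (Fin.suc j) λ ()))) (ℤₚ.+-identityʳ _)
ΣL-tabulate-single k f (Fin.suc i) h =
  trans (cong₂ ℤ._+_ (h Fin.zero λ ())
                     (ΣL-tabulate-single k (f ∘ Fin.suc) i λ j j≢i → h (Fin.suc j) (j≢i ∘ Finₚ.suc-injective)))
        (ℤₚ.+-identityˡ _)

ΣL-tabulate-const : ∀ {X : Set} {m} c (f : Fin m → X) → ΣL (λ _ → c) (tabulate f) ≡ + m ℤ.* c
ΣL-tabulate-const {m = zero} c f = sym (ℤₚ.*-zeroˡ c)
ΣL-tabulate-const {m = suc m} c f = trans (cong₂ ℤ._+_ (refl {x = c}) (ΣL-tabulate-const c (f ∘ Fin.suc))) (sym (ℤₚ.suc-* (+ m) c))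

-- Iterated difference operators, for vectors and for scalars alike.

module Difference {G : Set} (_∸_ : G → G → G) where

  Δ : G → (G → ℤ) → G → ℤ
  Δ v φ w = φ w − φ (w ∸ v)

  Δs : ∀ {m} → (Fin m → G) → (G → ℤ) → G → ℤ
  Δs {zero} f φ = φ
  Δs {suc m} f φ = Δ (f Fin.zero) (Δs (f ∘ Fin.suc) φ)

  Δs-cong : ∀ {m} (f : Fin m → G) {φ ψ} → φ ≗ ψ → Δs f φ ≗ Δs f ψ
  Δs-cong {zero} f h w = h w
  Δs-cong {suc m} f h w = cong₂ _−_ (Δs-cong (f ∘ Fin.suc) h w) (Δs-cong (f ∘ Fin.suc) h _)

  Δs-const : ∀ {m} (f : Fin m → G) → 0 < m → ∀ c w → Δs f (λ _ → c) w ≡ + 0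
  Δs-const {suc zero} f _ c w = ℤₚ.+-inverseʳ c
  Δs-const {suc (suc m)} f _ c w =
    cong₂ _−_ (Δs-const (f ∘ Fin.suc) (s≤s z≤n) c w) (Δs-const (f ∘ Fin.suc) (s≤s z≤n) c _)

  Δs-− : ∀ {m} (f : Fin m → G) φ ψ w → Δs f (λ u → φ u − ψ u) w ≡ Δs f φ w − Δs f ψ w
  Δs-− {zero} f φ ψ w = refl
  Δs-− {suc m} f φ ψ w = trans (cong₂ _−_ (Δs-− f′ φ ψ w) (Δs-− f′ φ ψ _))
    (−-−-interchange (Δs f′ φ w) (Δs f′ ψ w) (Δs f′ φ _) (Δs f′ ψ _))
    where
      f′ = f ∘ Fin.suc

  Δs-*ˡ : ∀ {m} (f : Fin m → G) c φ w → Δs f (λ u → c ℤ.* φ u) w ≡ c ℤ.* Δs f φ w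
  Δs-*ˡ {zero} f c φ w = refl
  Δs-*ˡ {suc m} f c φ w = trans (cong₂ _−_ (Δs-*ˡ f′ c φ w) (Δs-*ˡ f′ c φ _))
    (factor c (Δs f′ φ w) (Δs f′ φ _))
    where
      f′ = f ∘ Fin.suc
      factor : ∀ a b c → a ℤ.* b ℤ.+ (ℤ.- (a ℤ.* c)) ≡ a ℤ.* (b ℤ.+ (ℤ.- c))
      factor = solve-∀

  Δs-ΣL : ∀ {m} (f : Fin m → G) {X : Set} (φ : X → G → ℤ) xs w →
          Δs f (λ u → ΣL (λ x → φ x u) xs) w ≡ ΣL (λ x → Δs f (φ x) w) xs
  Δs-ΣL {zero} f φ xs w = refl
  Δs-ΣL {suc m} f φ xs w = trans (cong₂ _−_ (Δs-ΣL (f ∘ Fin.suc) φ xs w) (Δs-ΣL (f ∘ Fin.suc) φ xs _))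
    (sym (ΣL-− (λ x → Δs (f ∘ Fin.suc) (φ x) w) _ xs))

  Δs-split : ∀ m {n} (f : Fin (m ℕ.+ n) → G) φ w →
             Δs f φ w ≡ Δs (λ i → f (i ↑ˡ n)) (Δs (λ i → f (m ↑ʳ i)) φ) w
  Δs-split zero f φ w = refl
  Δs-split (suc m) f φ w = cong₂ _−_ (Δs-split m (f ∘ Fin.suc) φ w) (Δs-split m (f ∘ Fin.suc) φ _)

-- Signed binomial coefficients and divisibility of sums.

-- β m k is the coefficient of Xᵏ in (1 − X)ᵐ.
β : ℕ → ℕ → ℤ
β zero zero = + 1
β zero (suc k) = + 0
β (suc m) zero = β m zero
β (suc m) (suc k) = β m (suc k) − β m k

-- The absorption identity of binomial coefficients with alternating signs. At m + 1 = p the right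
-- side is a multiple of p, which leads to `p∣β` without factorials.
β-absorb : ∀ m k → + suc k ℤ.* β (suc m) (suc k) ≡ ℤ.- (+ suc m ℤ.* β m k)
β-absorb zero zero = refl
β-absorb zero (suc k) = ℤₚ.*-zeroʳ (+ suc (suc k))
β-absorb (suc m) zero = begin
  + 1 ℤ.* (β (suc m) 1 − B)                  ≡⟨ expand (β (suc m) 1) B ⟩
  + 1 ℤ.* β (suc m) 1 − B                    ≡⟨ cong (_− B) (β-absorb m zero) ⟩
  ℤ.- (+ suc m ℤ.* B) − B                    ≡⟨ collect (+ suc m) B ⟩
  ℤ.- ((+ 1 ℤ.+ + suc m) ℤ.* B)              ∎
  where
    B = β m zero
    expand : ∀ a b → + 1 ℤ.* (a ℤ.+ (ℤ.- b)) ≡ + 1 ℤ.* a ℤ.+ (ℤ.- b)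
    expand = solve-∀
    collect : ∀ q b → ℤ.- (q ℤ.* b) ℤ.+ (ℤ.- b) ≡ ℤ.- ((+ 1 ℤ.+ q) ℤ.* b)
    collect = solve-∀
β-absorb (suc m) (suc k) = begin
  (+ 1 ℤ.+ + suc k) ℤ.* (A − B)                                          ≡⟨ expand (+ suc k) A B ⟩
  ((+ 1 ℤ.+ + suc k) ℤ.* A − + suc k ℤ.* B) − B                          ≡⟨ cong₂ (λ s t → (s − t) − B) (β-absorb m (suc k)) (β-absorb m k) ⟩
  (ℤ.- (+ suc m ℤ.* β m (suc k)) − ℤ.- (+ suc m ℤ.* β m k)) − B          ≡⟨ collect (+ suc m) (β m (suc k)) (β m k) ⟩
  ℤ.- ((+ 1 ℤ.+ + suc m) ℤ.* B)                                          ∎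
  where
    A = β (suc m) (suc (suc k))
    B = β (suc m) (suc k)
    expand : ∀ k a b → (+ 1 ℤ.+ k) ℤ.* (a ℤ.+ (ℤ.- b)) ≡ ((+ 1 ℤ.+ k) ℤ.* a ℤ.+ (ℤ.- (k ℤ.* b))) ℤ.+ (ℤ.- b)
    expand = solve-∀
    collect : ∀ q x y → (ℤ.- (q ℤ.* x) ℤ.+ (ℤ.- (ℤ.- (q ℤ.* y)))) ℤ.+ (ℤ.- (x ℤ.+ (ℤ.- y)))
                      ≡ ℤ.- ((+ 1 ℤ.+ q) ℤ.* (x ℤ.+ (ℤ.- y)))
    collect = solve-∀

ΣN : ℕ → (ℕ → ℤ) → ℤ
ΣN zero f = + 0
ΣN (suc K) f = f 0 ℤ.+ ΣN K (f ∘ suc)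

ΣN-cong : ∀ K {f g} → f ≗ g → ΣN K f ≡ ΣN K g
ΣN-cong zero h = refl
ΣN-cong (suc K) h = cong₂ ℤ._+_ (h 0) (ΣN-cong K (h ∘ suc))

ΣN-zero : ∀ K {f} → (∀ k → f k ≡ + 0) → ΣN K f ≡ + 0
ΣN-zero zero h = refl
ΣN-zero (suc K) h = cong₂ ℤ._+_ (h 0) (ΣN-zero K (h ∘ suc))

ΣN-− : ∀ K f g → ΣN K (λ k → f k − g k) ≡ ΣN K f − ΣN K g
ΣN-− zero f g = refl
ΣN-− (suc K) f g = trans (cong₂ ℤ._+_ (refl {x = f 0 − g 0}) (ΣN-− K (f ∘ suc) (g ∘ suc)))
  (−-interchange (f 0) (g 0) (ΣN K (f ∘ suc)) (ΣN K (g ∘ suc)))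

∣-zero : ∀ d → d ℤ∣.∣ + 0
∣-zero d = divides (+ 0) (sym (ℤₚ.*-zeroˡ d))

ΣN-∣ : ∀ d K f → (∀ k → k < K → d ℤ∣.∣ f k) → d ℤ∣.∣ ΣN K f
ΣN-∣ d zero f h = ∣-zero d
ΣN-∣ d (suc K) f h = ℤ∣.∣m∣n⇒∣m+n (h 0 (s≤s z≤n)) (ΣN-∣ d K (f ∘ suc) (λ k k<K → h (suc k) (s≤s k<K)))

module _ (p : ℕ) {{_ : NonZero p}} where
  open Fp p

  -- The ring structure of 𝔽ₚ.

  [_] : ℕ → F
  [ a ] = a mod p

  toℕ-[] : ∀ a → toℕ [ a ] ≡ a % p
  toℕ-[] a = toℕ-fromℕ< (DM.m%n<n a p)

  []-cong : ∀ {a b} → a % p ≡ b % p → [ a ] ≡ [ b ]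
  []-cong {a} {b} eq = toℕ-injective (trans (toℕ-[] a) (trans eq (sym (toℕ-[] b))))

  [toℕ] : ∀ a → [ toℕ a ] ≡ a
  [toℕ] a = toℕ-injective (trans (toℕ-[] (toℕ a)) (DM.m<n⇒m%n≡m (toℕ<n a)))

  []-+ : ∀ a b → [ a ℕ.+ b ] ≡ [ a ] +F [ b ]
  []-+ a b = []-cong (trans (DM.%-distribˡ-+ a b p)
    (sym (cong₂ (λ x y → (x ℕ.+ y) % p) (toℕ-[] a) (toℕ-[] b))))

  []-* : ∀ a b → [ a ℕ.* b ] ≡ [ a ] *F [ b ]
  []-* a b = []-cong (trans (DM.%-distribˡ-* a b p)
    (sym (cong₂ (λ x y → (x ℕ.* y) % p) (toℕ-[] a) (toℕ-[] b))))

  [p]≡0 : [ p ] ≡ 0F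
  [p]≡0 = []-cong (trans (DM.n%n≡0 p) (sym (DM.m*n%n≡0 0 p)))

  -- Every element is the class of a natural number, so the ring laws descend from ℕ along `[]-+`
  -- and `[]-*`.
  F-ind : (P : F → Set) → (∀ a → P [ a ]) → ∀ a → P a
  F-ind P h a = subst P ([toℕ] a) (h (toℕ a))

  +F-assoc : ∀ a b c → (a +F b) +F c ≡ a +F (b +F c)
  +F-assoc = F-ind _ λ a → F-ind _ λ b → F-ind _ λ c → begin
    ([ a ] +F [ b ]) +F [ c ]  ≡⟨ cong (_+F [ c ]) (sym ([]-+ a b)) ⟩
    [ a ℕ.+ b ] +F [ c ]       ≡⟨ sym ([]-+ (a ℕ.+ b) c) ⟩
    [ a ℕ.+ b ℕ.+ c ]          ≡⟨ cong [_] (ℕₚ.+-assoc a b c) ⟩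
    [ a ℕ.+ (b ℕ.+ c) ]        ≡⟨ []-+ a (b ℕ.+ c) ⟩
    [ a ] +F [ b ℕ.+ c ]       ≡⟨ cong ([ a ] +F_) ([]-+ b c) ⟩
    [ a ] +F ([ b ] +F [ c ])  ∎

  *F-assoc : ∀ a b c → (a *F b) *F c ≡ a *F (b *F c)
  *F-assoc = F-ind _ λ a → F-ind _ λ b → F-ind _ λ c → begin
    ([ a ] *F [ b ]) *F [ c ]  ≡⟨ cong (_*F [ c ]) (sym ([]-* a b)) ⟩
    [ a ℕ.* b ] *F [ c ]       ≡⟨ sym ([]-* (a ℕ.* b) c) ⟩
    [ a ℕ.* b ℕ.* c ]          ≡⟨ cong [_] (ℕₚ.*-assoc a b c) ⟩
    [ a ℕ.* (b ℕ.* c) ]        ≡⟨ []-* a (b ℕ.* c) ⟩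
    [ a ] *F [ b ℕ.* c ]       ≡⟨ cong ([ a ] *F_) ([]-* b c) ⟩
    [ a ] *F ([ b ] *F [ c ])  ∎

  +F-comm : ∀ a b → a +F b ≡ b +F a
  +F-comm a b = cong [_] (ℕₚ.+-comm (toℕ a) (toℕ b))

  *F-comm : ∀ a b → a *F b ≡ b *F a
  *F-comm a b = cong [_] (ℕₚ.*-comm (toℕ a) (toℕ b))

  +F-identityˡ : ∀ a → 0F +F a ≡ a
  +F-identityˡ = F-ind _ λ a → sym ([]-+ 0 a)

  *F-identityˡ : ∀ a → 1F *F a ≡ a
  *F-identityˡ = F-ind _ λ a → trans (sym ([]-* 1 a)) (cong [_] (ℕₚ.*-identityˡ a))

  *F-distribˡ : ∀ a b c → a *F (b +F c) ≡ (a *F b) +F (a *F c)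
  *F-distribˡ = F-ind _ λ a → F-ind _ λ b → F-ind _ λ c → begin
    [ a ] *F ([ b ] +F [ c ])               ≡⟨ cong ([ a ] *F_) (sym ([]-+ b c)) ⟩
    [ a ] *F [ b ℕ.+ c ]                    ≡⟨ sym ([]-* a (b ℕ.+ c)) ⟩
    [ a ℕ.* (b ℕ.+ c) ]                     ≡⟨ cong [_] (ℕₚ.*-distribˡ-+ a b c) ⟩
    [ a ℕ.* b ℕ.+ a ℕ.* c ]                 ≡⟨ []-+ (a ℕ.* b) (a ℕ.* c) ⟩
    [ a ℕ.* b ] +F [ a ℕ.* c ]              ≡⟨ cong₂ _+F_ ([]-* a b) ([]-* a c) ⟩
    ([ a ] *F [ b ]) +F ([ a ] *F [ c ])    ∎

  -F-inverseʳ : ∀ a → a +F (-F a) ≡ 0F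
  -F-inverseʳ a = begin
    a +F [ p ℕ.∸ toℕ a ]            ≡⟨ cong (_+F [ p ℕ.∸ toℕ a ]) (sym ([toℕ] a)) ⟩
    [ toℕ a ] +F [ p ℕ.∸ toℕ a ]    ≡⟨ sym ([]-+ (toℕ a) (p ℕ.∸ toℕ a)) ⟩
    [ toℕ a ℕ.+ (p ℕ.∸ toℕ a) ]     ≡⟨ cong [_] (ℕₚ.m+[n∸m]≡n (ℕₚ.<⇒≤ (toℕ<n a))) ⟩
    [ p ]                           ≡⟨ [p]≡0 ⟩
    0F                              ∎

  F-isCommutativeRing : IsCommutativeRing _≡_ _+F_ _*F_ -F_ 0F 1F
  F-isCommutativeRing = record
    { isRing = record
      { +-isAbelianGroup = record
        { isGroup = record
          { isMonoid = record
            { isSemigroup = record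
              { isMagma = record { isEquivalence = isEquivalence ; ∙-cong = cong₂ _+F_ }
              ; assoc = +F-assoc }
            ; identity = +F-identityˡ , λ a → trans (+F-comm a 0F) (+F-identityˡ a) }
          ; inverse = (λ a → trans (+F-comm (-F a) a) (-F-inverseʳ a)) , -F-inverseʳ
          ; ⁻¹-cong = cong -F_ }
        ; comm = +F-comm }
      ; *-cong = cong₂ _*F_
      ; *-assoc = *F-assoc
      ; *-identity = *F-identityˡ , λ a → trans (*F-comm a 1F) (*F-identityˡ a)
      ; distrib = *F-distribˡ , λ a b c → trans (*F-comm (b +F c) a)
                    (trans (*F-distribˡ a b c) (cong₂ _+F_ (*F-comm a b) (*F-comm a c))) }
    ; *-comm = *F-comm }

  F-commutativeRing : CommutativeRing _ _
  F-commutativeRing = record { isCommutativeRing = F-isCommutativeRing }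

  module FR = CommutativeRing F-commutativeRing

  open RingProperties FR.ring
  open CommutativeSemigroupProperties (CommutativeMonoid.commutativeSemigroup FR.+-commutativeMonoid) using () renaming (interchange to +F-interchange)

  infixl 6 _⊖_
  _⊖_ : F → F → F
  a ⊖ b = a +F (-F b)

  ⊖-+-cancel : ∀ a b → (a ⊖ b) +F b ≡ a
  ⊖-+-cancel a b = trans (+F-assoc a (-F b) b)
    (trans (cong (a +F_) (FR.-‿inverseˡ b)) (FR.+-identityʳ a))

  +-⊖-cancel : ∀ a b → (a +F b) ⊖ b ≡ a
  +-⊖-cancel a b = trans (+F-assoc a b (-F b))
    (trans (cong (a +F_) (-F-inverseʳ b)) (FR.+-identityʳ a))

  ⊖-comm : ∀ a b c → (a ⊖ b) ⊖ c ≡ (a ⊖ c) ⊖ b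
  ⊖-comm a b c = trans (+F-assoc a (-F b) (-F c))
    (trans (cong (a +F_) (+F-comm (-F b) (-F c))) (sym (+F-assoc a (-F c) (-F b))))

  ⊖-assoc : ∀ a b c → (a ⊖ b) ⊖ c ≡ a ⊖ (b +F c)
  ⊖-assoc a b c = trans (+F-assoc a (-F b) (-F c)) (cong (a +F_) (-‿+-comm b c))

  ⊖-cancelʳ : ∀ a b c → (a ⊖ c) ⊖ (b ⊖ c) ≡ a ⊖ b
  ⊖-cancelʳ a b c = begin
    (a ⊖ c) ⊖ (b ⊖ c)   ≡⟨ ⊖-assoc a c (b ⊖ c) ⟩
    a ⊖ (c +F (b ⊖ c))  ≡⟨ cong (a ⊖_) (trans (+F-comm c (b ⊖ c)) (⊖-+-cancel b c)) ⟩
    a ⊖ b               ∎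

  ⊖-identityʳ : ∀ a → a ⊖ 0F ≡ a
  ⊖-identityʳ a = trans (cong (a +F_) -0#≈0#) (FR.+-identityʳ a)

  ⊖-self-difference : ∀ a b → a ⊖ (a ⊖ b) ≡ b
  ⊖-self-difference a b = begin
    a ⊖ (a ⊖ b)               ≡⟨ cong (_⊖ (a ⊖ b)) (sym (⊖-+-cancel a b)) ⟩
    ((a ⊖ b) +F b) ⊖ (a ⊖ b)  ≡⟨ cong (_⊖ (a ⊖ b)) (+F-comm (a ⊖ b) b) ⟩
    (b +F (a ⊖ b)) ⊖ (a ⊖ b)  ≡⟨ +-⊖-cancel b (a ⊖ b) ⟩
    b                         ∎

  ⊖-zero⇒≡ : ∀ {a b} → a ⊖ b ≡ 0F → a ≡ b
  ⊖-zero⇒≡ {a} {b} eq = trans (sym (⊖-+-cancel a b)) (trans (cong (_+F b) eq) (+F-identityˡ b))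

  -- Sums in 𝔽ₚ, vectors up to pointwise equality, and dot products.

  ΣF-cong : ∀ {n} {f g : Fin n → F} → f ≗ g → ΣF f ≡ ΣF g
  ΣF-cong {zero} h = refl
  ΣF-cong {suc n} h = cong₂ _+F_ (h Fin.zero) (ΣF-cong (h ∘ Fin.suc))

  ΣF-zero : ∀ {n} {f : Fin n → F} → (∀ i → f i ≡ 0F) → ΣF f ≡ 0F
  ΣF-zero {zero} h = refl
  ΣF-zero {suc n} h = trans (cong₂ _+F_ (h Fin.zero) (ΣF-zero (h ∘ Fin.suc))) (+F-identityˡ 0F)

  ΣF-single : ∀ {n} {f : Fin n → F} i → (∀ j → j ≢ i → f j ≡ 0F) → ΣF f ≡ f i
  ΣF-single {f = f} Fin.zero h =
    trans (cong (f Fin.zero +F_) (ΣF-zero (λ j → h (Fin.suc j) λ ()))) (FR.+-identityʳ _)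
  ΣF-single {f = f} (Fin.suc i) h =
    trans (cong₂ _+F_ (h Fin.zero λ ()) (ΣF-single i λ j j≢i → h (Fin.suc j) (j≢i ∘ Finₚ.suc-injective)))
          (+F-identityˡ _)

  ΣF-⊖ : ∀ {n} (f g : Fin n → F) → ΣF (λ i → f i ⊖ g i) ≡ ΣF f ⊖ ΣF g
  ΣF-⊖ {zero} f g = sym (-F-inverseʳ 0F)
  ΣF-⊖ {suc n} f g = begin
    (f₀ ⊖ g₀) +F ΣF (λ i → f (Fin.suc i) ⊖ g (Fin.suc i))  ≡⟨ cong ((f₀ ⊖ g₀) +F_) (ΣF-⊖ (f ∘ Fin.suc) (g ∘ Fin.suc)) ⟩
    (f₀ ⊖ g₀) +F (F′ ⊖ G′)      ≡⟨ sym (+F-assoc (f₀ ⊖ g₀) F′ (-F G′)) ⟩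
    ((f₀ ⊖ g₀) +F F′) ⊖ G′      ≡⟨ cong (_⊖ G′) (trans (+F-assoc f₀ (-F g₀) F′) (trans (cong (f₀ +F_) (+F-comm (-F g₀) F′)) (sym (+F-assoc f₀ F′ (-F g₀))))) ⟩
    ((f₀ +F F′) ⊖ g₀) ⊖ G′      ≡⟨ ⊖-assoc (f₀ +F F′) g₀ G′ ⟩
    (f₀ +F F′) ⊖ (g₀ +F G′)     ∎
    where
      f₀ = f Fin.zero
      g₀ = g Fin.zero
      F′ = ΣF (f ∘ Fin.suc)
      G′ = ΣF (g ∘ Fin.suc)

  ΣF-*ˡ : ∀ {n} c (f : Fin n → F) → ΣF (λ i → c *F f i) ≡ c *F ΣF f
  ΣF-*ˡ {zero} c f = sym (FR.zeroʳ c)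
  ΣF-*ˡ {suc n} c f = trans (cong ((c *F f Fin.zero) +F_) (ΣF-*ˡ c (f ∘ Fin.suc)))
    (sym (*F-distribˡ c (f Fin.zero) (ΣF (f ∘ Fin.suc))))

  ΣF-+ : ∀ {n} (f g : Fin n → F) → ΣF (λ i → f i +F g i) ≡ ΣF f +F ΣF g
  ΣF-+ {zero} f g = sym (+F-identityˡ 0F)
  ΣF-+ {suc n} f g = trans (cong ((f Fin.zero +F g Fin.zero) +F_) (ΣF-+ (f ∘ Fin.suc) (g ∘ Fin.suc)))
    (+F-interchange (f Fin.zero) (g Fin.zero) _ _)

  ΣF-swap : ∀ {m n} (f : Fin m → Fin n → F) → ΣF (λ i → ΣF (f i)) ≡ ΣF (λ j → ΣF (λ i → f i j))
  ΣF-swap {zero} {n} f = sym (ΣF-zero {n} (λ _ → refl))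
  ΣF-swap {suc m} f = trans (cong (ΣF (f Fin.zero) +F_) (ΣF-swap (f ∘ Fin.suc)))
    (sym (ΣF-+ (f Fin.zero) (λ j → ΣF (λ i → f (Fin.suc i) j))))

  ΣF-split : ∀ m {n} (f : Fin (m ℕ.+ n) → F) → ΣF f ≡ ΣF (λ i → f (i ↑ˡ n)) +F ΣF (λ i → f (m ↑ʳ i))
  ΣF-split zero f = sym (+F-identityˡ _)
  ΣF-split (suc m) f = trans (cong (f Fin.zero +F_) (ΣF-split m (f ∘ Fin.suc))) (sym (+F-assoc _ _ _))

  ΣF-combine : ∀ k {n} (f : Fin (k ℕ.* n) → F) → ΣF f ≡ ΣF (λ (j : Fin k) → ΣF (λ i → f (combine j i)))
  ΣF-combine zero f = refl
  ΣF-combine (suc k) {n} f = trans (ΣF-split n f)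
    (cong (ΣF (λ i → f (i ↑ˡ (k ℕ.* n))) +F_) (ΣF-combine k (λ i → f (n ↑ʳ i))))

  infix 4 _≈_
  _≈_ : ∀ {n} → Vec n → Vec n → Set
  v ≈ w = ∀ i → v i ≡ w i

  dot : ∀ {n} → Vec n → Vec n → F
  dot v w = ΣF (λ j → v j *F w j)

  dot-cong : ∀ {n} {v v′ w w′ : Vec n} → v ≈ v′ → w ≈ w′ → dot v w ≡ dot v′ w′
  dot-cong h k = ΣF-cong (λ j → cong₂ _*F_ (h j) (k j))

  dot-comm : ∀ {n} (v w : Vec n) → dot v w ≡ dot w v
  dot-comm v w = ΣF-cong (λ j → *F-comm (v j) (w j))

  dot--v : ∀ {n} (x w v : Vec n) → dot x (w -v v) ≡ dot x w ⊖ dot x v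
  dot--v x w v = trans
    (ΣF-cong (λ j → trans (*F-distribˡ (x j) (w j) (-F v j))
                          (cong ((x j *F w j) +F_) (sym (-‿distribʳ-* (x j) (v j))))))
    (ΣF-⊖ (λ j → x j *F w j) (λ j → x j *F v j))

  dot-*ˡ : ∀ {n} c (v w : Vec n) → dot v (λ j → c *F w j) ≡ c *F dot v w
  dot-*ˡ c v w = trans (ΣF-cong (λ j → trans (sym (*F-assoc (v j) c (w j)))
      (trans (cong (_*F w j) (*F-comm (v j) c)) (*F-assoc c (v j) (w j)))))
    (ΣF-*ˡ c (λ j → v j *F w j))

  e-diagonal : ∀ {n} (i : Fin n) → e i i ≡ 1F
  e-diagonal i with i Finₚ.≟ i
  ... | yes _ = refl
  ... | no i≢i = ⊥-elim (i≢i refl)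

  e-off-diagonal : ∀ {n} {i j : Fin n} → i ≢ j → e i j ≡ 0F
  e-off-diagonal {i = i} {j} i≢j with i Finₚ.≟ j
  ... | yes i≡j = ⊥-elim (i≢j i≡j)
  ... | no _ = refl

  dot-e : ∀ {n} (i : Fin n) (x : Vec n) → dot (e i) x ≡ x i
  dot-e i x = trans
    (ΣF-single i (λ j j≢i → trans (cong (_*F x j) (e-off-diagonal (j≢i ∘ sym))) (FR.zeroˡ (x j))))
    (trans (cong (_*F x i) (e-diagonal i)) (*F-identityˡ (x i)))

  -- Vectors are functions, and equal entries do not make them propositionally equal;
  -- well-definedness of a function on 𝔽ₚⁿ must therefore be carried along explicitly.
  Ext : ∀ {n} → (Vec n → ℤ) → Set
  Ext φ = ∀ {v w} → v ≈ w → φ v ≡ φ w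

  ◂-η : ∀ {n} (v : Vec (suc n)) → (v Fin.zero ◂ (v ∘ Fin.suc)) ≈ v
  ◂-η v Fin.zero = refl
  ◂-η v (Fin.suc i) = refl

  ◂-cong : ∀ {n} a {v w : Vec n} → v ≈ w → (a ◂ v) ≈ (a ◂ w)
  ◂-cong a h Fin.zero = refl
  ◂-cong a h (Fin.suc i) = h i

  -- Sums over 𝔽ₚⁿ and point masses.

  Σv : ∀ {n} → (Vec n → ℤ) → ℤ
  Σv {n} k = ΣL k (allVecs n)

  Σv-suc : ∀ {n} (k : Vec (suc n) → ℤ) → Σv k ≡ ΣL (λ a → Σv (λ v → k (a ◂ v))) (allFin p)
  Σv-suc {n} k = trans (ΣL-concatMap k (λ a → map (a ◂_) (allVecs n)) (allFin p))
    (ΣL-cong (allFin p) (λ a → ΣL-map k (a ◂_) (allVecs n)))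

  -- `allVecs` lists one representative of each vector, in general not v itself; `Ext` carries the
  -- value over to v.
  Σv-single : ∀ {n} (k : Vec n → ℤ) → Ext k → ∀ v → (∀ w → ¬ (w ≈ v) → k w ≡ + 0) → Σv k ≡ k v
  Σv-single {zero} k ext v h = trans (ℤₚ.+-identityʳ _) (ext λ ())
  Σv-single {suc n} k ext v h = begin
    Σv k                                             ≡⟨ Σv-suc k ⟩
    ΣL (λ a → Σv (λ w → k (a ◂ w))) (allFin p)       ≡⟨ ΣL-tabulate-single (λ a → Σv (λ w → k (a ◂ w))) id (v Fin.zero)
                                                          (λ a a≢ → ΣL-zero (allVecs n) (λ w → h (a ◂ w) (λ eq → a≢ (eq Fin.zero)))) ⟩
    Σv (λ w → k (v Fin.zero ◂ w))                    ≡⟨ Σv-single (λ w → k (v Fin.zero ◂ w)) (ext ∘ ◂-cong (v Fin.zero)) (v ∘ Fin.suc)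
                                                          (λ w w≉ → h (v Fin.zero ◂ w) (λ eq → w≉ (eq ∘ Fin.suc))) ⟩
    k (v Fin.zero ◂ (v ∘ Fin.suc))                   ≡⟨ ext (◂-η v) ⟩
    k v                                              ∎

  open GRℤ

  _≈?_ : ∀ {n} (v w : Vec n) → Dec (v ≈ w)
  v ≈? w = all? (λ i → v i Finₚ.≟ w i)

  g^-hit : ∀ {n} {v w : Vec n} → v ≈ w → g^ v w ≡ + 1
  g^-hit {v = v} {w} v≈w = cong (λ b → if b then + 1 else + 0) (dec-true (v ≈? w) v≈w)

  g^-miss : ∀ {n} {v w : Vec n} → ¬ (v ≈ w) → g^ v w ≡ + 0
  g^-miss {v = v} {w} v≉w = cong (λ b → if b then + 1 else + 0) (dec-false (v ≈? w) v≉w)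

  ≈-sym : ∀ {n} {v w : Vec n} → v ≈ w → w ≈ v
  ≈-sym h i = sym (h i)

  ≈-trans : ∀ {n} {u v w : Vec n} → u ≈ v → v ≈ w → u ≈ w
  ≈-trans h k i = trans (h i) (k i)

  g^-cong : ∀ {n} {u v u′ v′ : Vec n} → (u ≈ v → u′ ≈ v′) → (u′ ≈ v′ → u ≈ v) → g^ u v ≡ g^ u′ v′
  g^-cong {u = u} {v} f g with u ≈? v
  ... | yes h = trans (g^-hit h) (sym (g^-hit (f h)))
  ... | no h = trans (g^-miss h) (sym (g^-miss (h ∘ g)))

  g^-ext : ∀ {n} (v : Vec n) → Ext (g^ v)
  g^-ext v h = g^-cong (λ k → ≈-trans k h) (λ k → ≈-trans k (≈-sym h))

  Σv-g^ : ∀ {n} (v : Vec n) (k : Vec n → ℤ) → Ext k → Σv (λ w → g^ v w ℤ.* k w) ≡ k v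
  Σv-g^ v k ext = begin
    Σv (λ w → g^ v w ℤ.* k w)   ≡⟨ Σv-single _ (λ h → cong₂ ℤ._*_ (g^-ext v h) (ext h)) v
                                     (λ w w≉v → cong (ℤ._* k w) (g^-miss (w≉v ∘ ≈-sym))) ⟩
    g^ v v ℤ.* k v              ≡⟨ cong (ℤ._* k v) (g^-hit {v = v} (λ _ → refl)) ⟩
    + 1 ℤ.* k v                 ≡⟨ ℤₚ.*-identityˡ (k v) ⟩
    k v                         ∎

  -v-congˡ : ∀ {n} {v v′ : Vec n} (w : Vec n) → v ≈ v′ → (v -v w) ≈ (v′ -v w)
  -v-congˡ w h i = cong (_⊖ w i) (h i)

  -v-congʳ : ∀ {n} (v : Vec n) {w w′ : Vec n} → w ≈ w′ → (v -v w) ≈ (v -v w′)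
  -v-congʳ v h i = cong (v i ⊖_) (h i)

  -- No permutation of the list `allVecs` is constructed: k is expanded into point masses, the two
  -- sums are exchanged, and the translation moves to the position of the point mass, which has
  -- total weight 1 wherever it sits.
  Σv-shift : ∀ {n} (v : Vec n) (k : Vec n → ℤ) → Ext k → Σv (λ w → k (w -v v)) ≡ Σv k
  Σv-shift {n} v k ext = begin
    Σv (λ w → k (w -v v))                            ≡⟨ ΣL-cong (allVecs n) (λ w → sym (Σv-g^ (w -v v) k ext)) ⟩
    Σv (λ w → Σv (λ u → g^ (w -v v) u ℤ.* k u))      ≡⟨ ΣL-swap (λ w u → g^ (w -v v) u ℤ.* k u) (allVecs n) (allVecs n) ⟩
    Σv (λ u → Σv (λ w → g^ (w -v v) u ℤ.* k u))      ≡⟨ ΣL-cong (allVecs n) (λ u → ΣL-cong (allVecs n) (λ w → cong (ℤ._* k u) (move w u))) ⟩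
    Σv (λ u → Σv (λ w → g^ (λ i → u i +F v i) w ℤ.* k u))  ≡⟨ ΣL-cong (allVecs n) (λ u → Σv-g^ (λ i → u i +F v i) (λ _ → k u) (λ _ → refl)) ⟩
    Σv k                                             ∎
    where
      move : ∀ w u → g^ (w -v v) u ≡ g^ (λ i → u i +F v i) w
      move w u = g^-cong
        (λ h i → trans (cong (_+F v i) (sym (h i))) (⊖-+-cancel (w i) (v i)))
        (λ h i → trans (cong (_⊖ v i) (sym (h i))) (+-⊖-cancel (u i) (v i)))

  -- The group ring products as iterated differences of δ₀.

  module V {n} = Difference (_-v_ {n})
  module S = Difference _⊖_

  Δ-ext : ∀ {n} (v : Vec n) {φ} → Ext φ → Ext (V.Δ v φ)
  Δ-ext v ext h = cong₂ _−_ (ext h) (ext (-v-congˡ v h))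

  Δs-ext : ∀ {n m} (f : Fin m → Vec n) {φ} → Ext φ → Ext (V.Δs f φ)
  Δs-ext {m = zero} f ext = ext
  Δs-ext {m = suc m} f ext = Δ-ext (f Fin.zero) (Δs-ext (f ∘ Fin.suc) ext)

  Δ-comm : ∀ {n} (u v : Vec n) {φ} → Ext φ → V.Δ u (V.Δ v φ) ≗ V.Δ v (V.Δ u φ)
  Δ-comm u v {φ} ext w = trans
    (cong (λ x → (φ w − φ (w -v v)) − (φ (w -v u) − x)) (ext (λ i → ⊖-comm (w i) (u i) (v i))))
    (−-−-interchange (φ w) (φ (w -v v)) (φ (w -v u)) _)

  Δs-translate : ∀ {n m} (f : Fin m → Vec n) u {φ} → Ext φ → ∀ w → V.Δs f (λ v → φ (v -v u)) w ≡ V.Δs f φ (w -v u)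
  Δs-translate {m = zero} f u ext w = refl
  Δs-translate {m = suc m} f u {φ} ext w = cong₂ _−_ (Δs-translate (f ∘ Fin.suc) u ext w)
    (trans (Δs-translate (f ∘ Fin.suc) u ext (w -v f Fin.zero))
           (Δs-ext (f ∘ Fin.suc) ext (λ i → ⊖-comm (w i) (f Fin.zero i) (u i))))

  1R-* : ∀ {n} (h : Vec n → ℤ) → Ext h → ∀ w → (1R *R h) w ≡ h w
  1R-* h ext w = trans (Σv-g^ 0v (λ u → h (w -v u)) (λ k → ext (-v-congʳ w k)))
    (ext (λ i → ⊖-identityʳ (w i)))

  [1-g]*-Δ : ∀ {n} (v : Vec n) (h : Vec n → ℤ) → Ext h → ∀ w → ((1R -R g^ v) *R h) w ≡ V.Δ v h w
  [1-g]*-Δ {n} v h ext w = begin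
    Σv (λ u → (1R u − g^ v u) ℤ.* h (w -v u))                          ≡⟨ ΣL-cong (allVecs n) (λ u → *-distribʳ-− (1R u) (g^ v u) (h (w -v u))) ⟩
    Σv (λ u → (1R u ℤ.* h (w -v u)) − (g^ v u ℤ.* h (w -v u)))         ≡⟨ ΣL-− (λ u → 1R u ℤ.* h (w -v u)) (λ u → g^ v u ℤ.* h (w -v u)) (allVecs n) ⟩
    (1R *R h) w − Σv (λ u → g^ v u ℤ.* h (w -v u))                     ≡⟨ cong₂ _−_ (1R-* h ext w) (Σv-g^ v (λ u → h (w -v u)) (λ k → ext (-v-congʳ w k))) ⟩
    h w − h (w -v v)                                                   ∎

  -- Associativity of convolution in the one case required: translating the left factor by v
  -- amounts, after reindexing with `Σv-shift`, to translating the whole convolution.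
  Δ-* : ∀ {n} (v : Vec n) {f h : Vec n → ℤ} → Ext f → Ext h → ∀ w → (V.Δ v f *R h) w ≡ V.Δ v (f *R h) w
  Δ-* {n} v {f} {h} extf exth w = begin
    Σv (λ u → (f u − f (u -v v)) ℤ.* h (w -v u))                       ≡⟨ ΣL-cong (allVecs n) (λ u → *-distribʳ-− (f u) (f (u -v v)) (h (w -v u))) ⟩
    Σv (λ u → (f u ℤ.* h (w -v u)) − (f (u -v v) ℤ.* h (w -v u)))      ≡⟨ ΣL-− (λ u → f u ℤ.* h (w -v u)) (λ u → f (u -v v) ℤ.* h (w -v u)) (allVecs n) ⟩
    (f *R h) w − Σv (λ u → f (u -v v) ℤ.* h (w -v u))                  ≡⟨ cong ((f *R h) w −_) (ΣL-cong (allVecs n) λ u → cong (f (u -v v) ℤ.*_)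
                                                                            (exth (λ i → sym (⊖-cancelʳ (w i) (u i) (v i))))) ⟩
    (f *R h) w − Σv (λ u → k (u -v v))                                 ≡⟨ cong ((f *R h) w −_) (Σv-shift v k (λ q → cong₂ ℤ._*_ (extf q) (exth (-v-congʳ (w -v v) q)))) ⟩
    (f *R h) w − (f *R h) (w -v v)                                     ∎
    where
      k : Vec n → ℤ
      k u = f u ℤ.* h ((w -v v) -v u)

  Δs-* : ∀ {n m} (f : Fin m → Vec n) {φ h} → Ext φ → Ext h → ∀ w → (V.Δs f φ *R h) w ≡ V.Δs f (φ *R h) w
  Δs-* {m = zero} f extφ exth w = refl
  Δs-* {m = suc m} f extφ exth w = trans (Δ-* (f Fin.zero) (Δs-ext (f ∘ Fin.suc) extφ) exth w)
    (cong₂ _−_ (Δs-* (f ∘ Fin.suc) extφ exth w) (Δs-* (f ∘ Fin.suc) extφ exth _))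

  1R-ext : ∀ {n} → Ext (1R {n})
  1R-ext = g^-ext 0v

  ∏R-Δs : ∀ {n m} (f : Fin m → Vec n) → ∏R (λ i → 1R -R g^ (f i)) ≗ V.Δs f 1R
  ∏R-Δs {m = zero} f w = refl
  ∏R-Δs {n} {suc m} f w = trans
    (ΣL-cong (allVecs n) (λ u → cong ((1R -R g^ (f Fin.zero)) u ℤ.*_) (∏R-Δs (f ∘ Fin.suc) (w -v u))))
    ([1-g]*-Δ (f Fin.zero) _ (Δs-ext (f ∘ Fin.suc) 1R-ext) w)

  -- `1R` is the unit of convolution, so the operators of the first factor pass through the product
  -- and land on the second factor.
  expr-Δs : ∀ {n} (M : Mat n) → expr M ≗ V.Δs e (V.Δs M 1R)
  expr-Δs {n} M w = begin
    expr M w                          ≡⟨ ΣL-cong (allVecs n) (λ u → cong₂ ℤ._*_ (∏R-Δs e u) (∏R-Δs M (w -v u))) ⟩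
    (V.Δs e 1R *R V.Δs M 1R) w        ≡⟨ Δs-* e 1R-ext extM w ⟩
    V.Δs e (1R *R V.Δs M 1R) w        ≡⟨ V.Δs-cong e (1R-* (V.Δs M 1R) extM) w ⟩
    V.Δs e (V.Δs M 1R) w              ∎
    where
      extM : Ext (V.Δs M 1R)
      extM = Δs-ext M 1R-ext

  -- Functions of one linear form, and reduction of all functions to δ₀.

  Δs-dot : ∀ {n m} (f : Fin m → Vec n) (x : Vec n) (h : F → ℤ) w →
           V.Δs f (h ∘ dot x) w ≡ S.Δs (dot x ∘ f) h (dot x w)
  Δs-dot {m = zero} f x h w = refl
  Δs-dot {m = suc m} f x h w = cong₂ _−_ (Δs-dot (f ∘ Fin.suc) x h w)
    (trans (Δs-dot (f ∘ Fin.suc) x h (w -v f Fin.zero)) (cong (S.Δs (dot x ∘ f ∘ Fin.suc) h) (dot--v x w (f Fin.zero))))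

  -- A difference with step 0 is the zero operator. Together with `Δs-dot`, this is how
  -- orthogonality of x to one vector kills the contribution of x.
  S-Δs-vanish : ∀ {m} (c : Fin m → F) i → c i ≡ 0F → ∀ h t → S.Δs c h t ≡ + 0
  S-Δs-vanish c Fin.zero c₀≡0 h t = trans
    (cong (λ s → ψ t − ψ s) (trans (cong (t ⊖_) c₀≡0) (⊖-identityʳ t))) (ℤₚ.+-inverseʳ (ψ t))
    where ψ = S.Δs (c ∘ Fin.suc) h
  S-Δs-vanish c (Fin.suc i) cᵢ≡0 h t = cong₂ _−_ (S-Δs-vanish (c ∘ Fin.suc) i cᵢ≡0 h t) (S-Δs-vanish (c ∘ Fin.suc) i cᵢ≡0 h _)

  S-Δs-congᶠ : ∀ {m} {c d : Fin m → F} → c ≗ d → ∀ h → S.Δs c h ≗ S.Δs d h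
  S-Δs-congᶠ {zero} eq h t = refl
  S-Δs-congᶠ {suc m} {c} {d} eq h t = cong₂ _−_ (S-Δs-congᶠ (eq ∘ Fin.suc) h t)
    (trans (S-Δs-congᶠ (eq ∘ Fin.suc) h _) (cong (λ s → S.Δs (d ∘ Fin.suc) h (t ⊖ s)) (eq Fin.zero)))

  δF : F → ℤ
  δF t = if does (t Finₚ.≟ 0F) then + 1 else + 0

  δF-hit : ∀ {t} → t ≡ 0F → δF t ≡ + 1
  δF-hit {t} eq = cong (λ b → if b then + 1 else + 0) (dec-true (t Finₚ.≟ 0F) eq)

  δF-miss : ∀ {t} → t ≢ 0F → δF t ≡ + 0
  δF-miss {t} neq = cong (λ b → if b then + 1 else + 0) (dec-false (t Finₚ.≟ 0F) neq)

  Σv-1 : ∀ n → Σv {n} (λ _ → + 1) ≡ + (p ℕ.^ n)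
  Σv-1 zero = refl
  Σv-1 (suc n) = begin
    Σv {suc n} (λ _ → + 1)                          ≡⟨ Σv-suc {n} (λ _ → + 1) ⟩
    ΣL (λ a → Σv {n} (λ _ → + 1)) (allFin p)        ≡⟨ ΣL-cong (allFin p) (λ _ → Σv-1 n) ⟩
    ΣL (λ a → + (p ℕ.^ n)) (allFin p)               ≡⟨ ΣL-tabulate-const {m = p} (+ (p ℕ.^ n)) id ⟩
    + p ℤ.* + (p ℕ.^ n)                             ≡⟨ sym (ℤₚ.pos-* p (p ℕ.^ n)) ⟩
    + (p ℕ.* p ℕ.^ n)                               ∎

  Δs-*R : ∀ {n m} (f : Fin m → Vec n) φ {h} → Ext h → V.Δs f (φ *R h) ≗ φ *R V.Δs f h
  Δs-*R {n} f φ {h} ext w = begin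
    V.Δs f (λ v → Σv (λ u → φ u ℤ.* h (v -v u))) w       ≡⟨ V.Δs-ΣL f (λ u v → φ u ℤ.* h (v -v u)) (allVecs n) w ⟩
    Σv (λ u → V.Δs f (λ v → φ u ℤ.* h (v -v u)) w)       ≡⟨ ΣL-cong (allVecs n) (λ u → trans (V.Δs-*ˡ f (φ u) (λ v → h (v -v u)) w)
                                                              (cong (φ u ℤ.*_) (Δs-translate f u ext w))) ⟩
    (φ *R V.Δs f h) w                                    ∎

  *R-1R : ∀ {n} (φ : Vec n → ℤ) → Ext φ → ∀ w → (φ *R 1R) w ≡ φ w
  *R-1R {n} φ ext w = trans
    (ΣL-cong (allVecs n) λ u → trans (ℤₚ.*-comm (φ u) (1R (w -v u))) (cong (ℤ._* φ u) (move u)))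
    (Σv-g^ w φ ext)
    where
      move : ∀ u → g^ 0v (w -v u) ≡ g^ w u
      move u = g^-cong (λ h i → ⊖-zero⇒≡ (sym (h i)))
                       (λ h i → sym (trans (cong (_⊖ u i) (h i)) (-F-inverseʳ (u i))))

  -- Every φ is a convolution φ * δ₀, and the operators act on the right factor alone; an operator
  -- that kills δ₀ kills everything. This allows testing a vanishing product on hyperplane
  -- indicators.
  Δs-vanish-all : ∀ {n m l} (f : Fin m → Vec n) (g : Fin l → Vec n) → IsZero (V.Δs f (V.Δs g 1R)) →
                  ∀ φ → Ext φ → IsZero (V.Δs f (V.Δs g φ))
  Δs-vanish-all {n} f g zeros φ ext w = begin
    V.Δs f (V.Δs g φ) w                  ≡⟨ V.Δs-cong f (V.Δs-cong g (λ u → sym (*R-1R φ ext u))) w ⟩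
    V.Δs f (V.Δs g (φ *R 1R)) w          ≡⟨ V.Δs-cong f (Δs-*R g φ 1R-ext) w ⟩
    V.Δs f (φ *R V.Δs g 1R) w            ≡⟨ Δs-*R f φ (Δs-ext g 1R-ext) w ⟩
    (φ *R V.Δs f (V.Δs g 1R)) w          ≡⟨ ΣL-zero (allVecs n) (λ u → trans (cong (φ u ℤ.*_) (zeros (w -v u))) (ℤₚ.*-zeroʳ (φ u))) ⟩
    + 0                                  ∎

  -- Binomial expansion of (1 - gᶻ)ᵐ along the orbit u j, u j - z, and so on. The parameter d pads
  -- the sum with terms whose coefficient is zero: in the inductive step the two expansions start at
  -- j and j + 1, and unequal padding makes them line up for Pascal's rule.
  Δs-binomial : ∀ {n} (z : Vec n) {φ} → Ext φ → (u : ℕ → Vec n) → (∀ j → u (suc j) ≈ (u j -v z)) →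
                ∀ m d j → V.Δs {m = m} (λ _ → z) φ (u j) ≡ ΣN (suc m ℕ.+ d) (λ k → β m k ℤ.* φ (u (j ℕ.+ k)))
  Δs-binomial z {φ} ext u step zero d j = sym (begin
    + 1 ℤ.* φ (u (j ℕ.+ 0)) ℤ.+ ΣN d (λ k → + 0 ℤ.* φ (u (j ℕ.+ suc k)))   ≡⟨ cong₂ ℤ._+_ (ℤₚ.*-identityˡ (φ (u (j ℕ.+ 0)))) (ΣN-zero d (λ k → ℤₚ.*-zeroˡ (φ (u (j ℕ.+ suc k))))) ⟩
    φ (u (j ℕ.+ 0)) ℤ.+ + 0                                                ≡⟨ ℤₚ.+-identityʳ _ ⟩
    φ (u (j ℕ.+ 0))                                                        ≡⟨ cong (φ ∘ u) (ℕₚ.+-identityʳ j) ⟩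
    φ (u j)                                                                ∎)
  Δs-binomial z {φ} ext u step (suc m) d j = begin
    Δm (u j) − Δm (u j -v z)                        ≡⟨ cong (Δm (u j) −_) (Δs-ext {m = m} (λ _ → z) ext (≈-sym (step j))) ⟩
    Δm (u j) − Δm (u (suc j))                       ≡⟨ cong₂ _−_ (Δs-binomial z ext u step m (suc d) j) (Δs-binomial z ext u step m d (suc j)) ⟩
    ΣN (suc m ℕ.+ suc d) T − R                      ≡⟨ cong (λ K → ΣN (suc K) T − R) (ℕₚ.+-suc m d) ⟩
    (T 0 ℤ.+ ΣN (suc m ℕ.+ d) (T ∘ suc)) − R        ≡⟨ ℤₚ.+-assoc (T 0) (ΣN (suc m ℕ.+ d) (T ∘ suc)) (ℤ.- R) ⟩
    T 0 ℤ.+ (ΣN (suc m ℕ.+ d) (T ∘ suc) − R)        ≡⟨ cong₂ ℤ._+_ (refl {x = T 0}) (sym (ΣN-− (suc m ℕ.+ d) (T ∘ suc) (λ k → β m k ℤ.* φ (u (suc j ℕ.+ k))))) ⟩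
    T 0 ℤ.+ ΣN (suc m ℕ.+ d) (λ k → T (suc k) − β m k ℤ.* φ (u (suc j ℕ.+ k)))
                                                    ≡⟨ cong₂ ℤ._+_ (refl {x = T 0}) (ΣN-cong (suc m ℕ.+ d) merge) ⟩
    T 0 ℤ.+ ΣN (suc m ℕ.+ d) (λ k → β (suc m) (suc k) ℤ.* φ (u (j ℕ.+ suc k)))  ∎
    where
      Δm = V.Δs {m = m} (λ _ → z) φ
      T : ℕ → ℤ
      T k = β m k ℤ.* φ (u (j ℕ.+ k))
      R = ΣN (suc m ℕ.+ d) (λ k → β m k ℤ.* φ (u (suc j ℕ.+ k)))
      merge : ∀ k → T (suc k) − β m k ℤ.* φ (u (suc j ℕ.+ k)) ≡ β (suc m) (suc k) ℤ.* φ (u (j ℕ.+ suc k))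
      merge k = trans (cong (λ i → T (suc k) − β m k ℤ.* φ (u i)) (sym (ℕₚ.+-suc j k)))
                      (sym (*-distribʳ-− (β m (suc k)) (β m k) (φ (u (j ℕ.+ suc k)))))

  -- Divisibility by p after repeated differences in one direction.

  Δs-Δ-comm : ∀ {n m} (f : Fin m → Vec n) v {φ} → Ext φ → V.Δs f (V.Δ v φ) ≗ V.Δ v (V.Δs f φ)
  Δs-Δ-comm {m = zero} f v ext w = refl
  Δs-Δ-comm {m = suc m} f v ext w = trans
    (cong₂ _−_ (Δs-Δ-comm (f ∘ Fin.suc) v ext w) (Δs-Δ-comm (f ∘ Fin.suc) v ext _))
    (Δ-comm (f Fin.zero) v (Δs-ext (f ∘ Fin.suc) ext) w)

  -- In group ring terms, (1 - gᶻ)ᵏ φ ≡ 0 modulo p. The number k counts the factors 1 - gᶻ still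
  -- owed; at k = 0 the function φ itself is divisible by p.
  record Nil {n} (z : Vec n) (k : ℕ) (φ : Vec n → ℤ) : Set where
    field p∣Δᵏ : ∀ w → + p ℤ∣.∣ V.Δs {m = k} (λ _ → z) φ w
  open Nil

  Nil-Δ : ∀ {n} {z : Vec n} {k φ} v → Ext φ → Nil z k φ → Nil z k (V.Δ v φ)
  Nil-Δ {z = z} {k} v ext nil .p∣Δᵏ w = subst (+ p ℤ∣.∣_) (sym (Δs-Δ-comm {m = k} (λ _ → z) v ext w))
    (ℤ∣.∣m∣n⇒∣m-n (p∣Δᵏ nil w) (p∣Δᵏ nil (w -v v)))

  Nil-Δs : ∀ {n m} {z : Vec n} {k φ} (f : Fin m → Vec n) → Ext φ → Nil z k φ → Nil z k (V.Δs f φ)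
  Nil-Δs {m = zero} f ext nil = nil
  Nil-Δs {m = suc m} f ext nil = Nil-Δ (f Fin.zero) (Δs-ext (f ∘ Fin.suc) ext) (Nil-Δs (f ∘ Fin.suc) ext nil)

  Nil-cong : ∀ {n} {z : Vec n} {k φ ψ} → φ ≗ ψ → Nil z k φ → Nil z k ψ
  Nil-cong {z = z} {k} h nil .p∣Δᵏ w = subst (+ p ℤ∣.∣_) (V.Δs-cong {m = k} (λ _ → z) h w) (p∣Δᵏ nil w)

  -- A factor 1 - gᶻ actually present in the product pays one of the k owed; it is first commuted
  -- past the others.
  Nil-lower : ∀ {n} {z v : Vec n} {k φ} → v ≈ z → Ext φ → Nil z (suc k) φ → Nil z k (V.Δ v φ)
  Nil-lower {z = z} {v} {k} {φ} v≈z ext nil .p∣Δᵏ w = subst (+ p ℤ∣.∣_)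
    (trans (sym (Δs-Δ-comm {m = k} (λ _ → z) z ext w))
           (V.Δs-cong {m = k} (λ _ → z) (λ u → cong (φ u −_) (ext (-v-congʳ u (≈-sym v≈z)))) w))
    (p∣Δᵏ nil w)

  Nil-block : ∀ {n m} {z : Vec n} {k φ} (f : Fin m → Vec n) i → f i ≈ z → Ext φ → Nil z (suc k) φ → Nil z k (V.Δs f φ)
  Nil-block f Fin.zero f₀≈z ext nil = Nil-lower f₀≈z (Δs-ext (f ∘ Fin.suc) ext) (Nil-Δs (f ∘ Fin.suc) ext nil)
  Nil-block f (Fin.suc i) fᵢ≈z ext nil = Nil-Δ (f Fin.zero) (Δs-ext (f ∘ Fin.suc) ext) (Nil-block (f ∘ Fin.suc) i fᵢ≈z ext nil)

  -- Each of the l consecutive blocks of m vectors holds a copy of z at the same place i and pays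
  -- one factor, while the other vectors of the block leave the count unchanged.
  Nil-blocks : ∀ {n m} {z : Vec n} l {k φ} (f : Fin (l ℕ.* m) → Vec n) (i : Fin m) →
               (∀ (j : Fin l) → f (combine j i) ≈ z) → Ext φ → Nil z (l ℕ.+ k) φ → Nil z k (V.Δs f φ)
  Nil-blocks zero f i hit ext nil = nil
  Nil-blocks {m = m} {z} (suc l) {k} {φ} f i hit ext nil =
    Nil-cong (λ w → sym (V.Δs-split m f φ w))
      (Nil-block (λ j → f (j ↑ˡ (l ℕ.* m))) i (hit Fin.zero) (Δs-ext (λ j → f (m ↑ʳ j)) ext)
        (Nil-blocks l (λ j → f (m ↑ʳ j)) i (hit ∘ Fin.suc) ext
          (subst (λ k → Nil z k φ) (sym (ℕₚ.+-suc l k)) nil)))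

  -- Reduction of the group ring from ℤ to 𝔽ₚ.

  infix 4 _~_
  record _~_ (z : ℤ) (a : F) : Set where
    field p∣difference : + p ℤ∣.∣ z − + toℕ a
  open _~_

  -- All operations of `F` end in a reduction modulo p. This lemma absorbs that reduction, so the
  -- compatibility proofs below only compare integers with the unreduced natural number m.
  ~-[] : ∀ {z} m → + p ℤ∣.∣ z − + m → z ~ [ m ]
  ~-[] {z} m p∣z-m .p∣difference = subst (+ p ℤ∣.∣_) (telescope z (+ m) (+ toℕ [ m ])) (ℤ∣.∣m∣n⇒∣m+n p∣z-m (divides (+ (m DM./ p)) (begin
    + m − + toℕ [ m ]                                         ≡⟨ cong (λ r → + m − + r) (toℕ-[] m) ⟩
    + m − + (m % p)                                           ≡⟨ cong (λ r → + r − + (m % p)) (DM.m≡m%n+[m/n]*n m p) ⟩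
    + (m % p ℕ.+ (m DM./ p) ℕ.* p) − + (m % p)                ≡⟨ cong (_− + (m % p)) (ℤₚ.pos-+ (m % p) ((m DM./ p) ℕ.* p)) ⟩
    (+ (m % p) ℤ.+ + ((m DM./ p) ℕ.* p)) − + (m % p)          ≡⟨ cancel (+ (m % p)) (+ ((m DM./ p) ℕ.* p)) ⟩
    + ((m DM./ p) ℕ.* p)                                      ≡⟨ ℤₚ.pos-* (m DM./ p) p ⟩
    + (m DM./ p) ℤ.* + p                                      ∎)))
    where
      telescope : ∀ a b c → (a ℤ.+ (ℤ.- b)) ℤ.+ (b ℤ.+ (ℤ.- c)) ≡ a ℤ.+ (ℤ.- c)
      telescope = solve-∀
      cancel : ∀ a b → (a ℤ.+ b) ℤ.+ (ℤ.- a) ≡ b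
      cancel = solve-∀

  ~-0 : + 0 ~ 0F
  ~-0 = ~-[] 0 (∣-zero (+ p))

  ~-1 : + 1 ~ 1F
  ~-1 = ~-[] 1 (∣-zero (+ p))

  ~-+ : ∀ {y z a b} → y ~ a → z ~ b → y ℤ.+ z ~ a +F b
  ~-+ {y} {z} {a} {b} h k = ~-[] (toℕ a ℕ.+ toℕ b)
    (subst (+ p ℤ∣.∣_) (trans (−-interchange y (+ toℕ a) z (+ toℕ b)) (cong (y ℤ.+ z −_) (sym (ℤₚ.pos-+ (toℕ a) (toℕ b)))))
      (ℤ∣.∣m∣n⇒∣m+n (p∣difference h) (p∣difference k)))

  ~-* : ∀ {y z a b} → y ~ a → z ~ b → y ℤ.* z ~ a *F b
  ~-* {y} {z} {a} {b} h k = ~-[] (toℕ a ℕ.* toℕ b)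
    (subst (+ p ℤ∣.∣_) (trans (telescope y (+ toℕ a) z (+ toℕ b)) (cong (y ℤ.* z −_) (sym (ℤₚ.pos-* (toℕ a) (toℕ b)))))
      (ℤ∣.∣m∣n⇒∣m+n (ℤ∣.∣m⇒∣m*n z (p∣difference h)) (ℤ∣.∣n⇒∣m*n (+ toℕ a) (p∣difference k))))
    where
      telescope : ∀ a b c d → (a ℤ.+ (ℤ.- b)) ℤ.* c ℤ.+ b ℤ.* (c ℤ.+ (ℤ.- d)) ≡ a ℤ.* c ℤ.+ (ℤ.- (b ℤ.* d))
      telescope = solve-∀

  ~-neg : ∀ {z a} → z ~ a → ℤ.- z ~ -F a
  ~-neg {z} {a} h = ~-[] (p ℕ.∸ toℕ a)
    (subst (+ p ℤ∣.∣_) (trans (rearrange z (+ toℕ a) (+ p))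
        (cong (ℤ.- z −_) (trans (ℤₚ.m-n≡m⊖n p (toℕ a)) (ℤₚ.⊖-≥ (ℕₚ.<⇒≤ (toℕ<n a))))))
      (ℤ∣.∣m∣n⇒∣m-n (ℤ∣.∣m⇒∣-m (p∣difference h)) ℤ∣.∣-refl))
    where
      rearrange : ∀ z a p → ℤ.- (z ℤ.+ (ℤ.- a)) ℤ.+ (ℤ.- p) ≡ ℤ.- z ℤ.+ (ℤ.- (p ℤ.+ (ℤ.- a)))
      rearrange = solve-∀

  ~-∣⇒0 : ∀ {z a} → z ~ a → + p ℤ∣.∣ z → a ≡ 0F
  ~-∣⇒0 {z} {a} h p∣z = toℕ-injective (trans (sym (DM.m<n⇒m%n≡m (toℕ<n a)))
    (trans (ℕ∣.n∣m⇒m%n≡0 (toℕ a) p (ℤ∣.∣⇒∣ᵤ (subst (+ p ℤ∣.∣_) (cancel z (+ toℕ a)) (ℤ∣.∣m∣n⇒∣m-n p∣z (p∣difference h)))))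
           (sym (trans (toℕ-[] 0) (DM.m*n%n≡0 0 p)))))
    where
      cancel : ∀ z a → z ℤ.+ (ℤ.- (z ℤ.+ (ℤ.- a))) ≡ a
      cancel = solve-∀

  infix 4 _≃_
  _≃_ : ∀ {n} → GR n → GRFp.GR n → Set
  f ≃ g = ∀ w → f w ~ g w

  ≃-g^ : ∀ {n} (v : Vec n) → g^ v ≃ GRFp.g^ v
  ≃-g^ v w with v =v? w
  ... | true = ~-1
  ... | false = ~-0

  ≃-* : ∀ {n} {f h : GR n} {f′ h′ : GRFp.GR n} → f ≃ f′ → h ≃ h′ → (f *R h) ≃ (f′ GRFp.*R h′)
  ≃-* {n} {f} {h} {f′} {h′} rf rh v = go (allVecs n)
    where
      go : ∀ ws → foldr (λ w acc → (f w ℤ.* h (v -v w)) ℤ.+ acc) (+ 0) ws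
                ~ foldr (λ w acc → (f′ w *F h′ (v -v w)) +F acc) 0F ws
      go [] = ~-0
      go (w ∷ ws) = ~-+ (~-* (rf w) (rh (v -v w))) (go ws)

  ≃-∏ : ∀ {n m} (f : Fin m → Vec n) → ∏R (λ i → 1R -R g^ (f i)) ≃ GRFp.∏R (λ i → GRFp.1R GRFp.-R GRFp.g^ (f i))
  ≃-∏ {m = zero} f = ≃-g^ 0v
  ≃-∏ {m = suc m} f = ≃-* (λ w → ~-+ (≃-g^ 0v w) (~-neg (≃-g^ (f Fin.zero) w))) (≃-∏ (f ∘ Fin.suc))

  ≃-expr : ∀ {n} (M : Mat n) → expr M ≃ GRFp.expr M
  ≃-expr M = ≃-* (≃-∏ e) (≃-∏ M)

  -- The block matrix: coordinate 0 is z, then come l diagonal copies of A, with column c below z in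
  -- each copy.

  Block : ∀ l {n} → Vec n → Mat n → Mat (suc (l ℕ.* n))
  Block l c A Fin.zero Fin.zero = 1F
  Block l c A Fin.zero (Fin.suc r) = 0F
  Block l {n} c A (Fin.suc q) Fin.zero = c (proj₂ (remQuot {l} n q))
  Block l {n} c A (Fin.suc q) (Fin.suc r) =
    e (proj₁ (remQuot {l} n q)) (proj₁ (remQuot {l} n r)) *F A (proj₂ (remQuot {l} n q)) (proj₂ (remQuot {l} n r))

  combine-elim : ∀ l {n} (P : Fin (l ℕ.* n) → Set) → (∀ (j : Fin l) (i : Fin n) → P (combine j i)) → ∀ q → P q
  combine-elim l {n} P h q = subst P (Finₚ.combine-remQuot {l} n q) (h _ _)

  module _ (l : ℕ) {n : ℕ} (c : Vec n) (A : Mat n) where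

    Block-column : ∀ (j : Fin l) (i : Fin n) → Block l c A (Fin.suc (combine j i)) Fin.zero ≡ c i
    Block-column j i = cong (c ∘ proj₂) (Finₚ.remQuot-combine j i)

    Block-entry : ∀ (j j′ : Fin l) (i i′ : Fin n) →
                  Block l c A (Fin.suc (combine j i)) (Fin.suc (combine j′ i′)) ≡ e j j′ *F A i i′
    Block-entry j j′ i i′ = cong₂ (λ x y → e (proj₁ x) (proj₁ y) *F A (proj₂ x) (proj₂ y))
      (Finₚ.remQuot-combine j i) (Finₚ.remQuot-combine j′ i′)

    Block-·v-zero : ∀ y → (Block l c A ·v y) Fin.zero ≡ y Fin.zero
    Block-·v-zero y = trans (cong₂ _+F_ (*F-identityˡ (y Fin.zero)) (ΣF-zero (λ r → FR.zeroˡ (y (Fin.suc r)))))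
      (FR.+-identityʳ (y Fin.zero))

    Block-·v : ∀ y (j : Fin l) (i : Fin n) → (Block l c A ·v y) (Fin.suc (combine j i)) ≡
               (c i *F y Fin.zero) +F dot (A i) (λ i′ → y (Fin.suc (combine j i′)))
    Block-·v y j i = cong₂ _+F_ (cong (_*F y Fin.zero) (Block-column j i)) (begin
      ΣF (λ r → Block l c A (Fin.suc (combine j i)) (Fin.suc r) *F y (Fin.suc r))
        ≡⟨ ΣF-combine l (λ r → Block l c A (Fin.suc (combine j i)) (Fin.suc r) *F y (Fin.suc r)) ⟩
      ΣF (λ (j′ : Fin l) → ΣF (λ (i′ : Fin n) → Block l c A (Fin.suc (combine j i)) (Fin.suc (combine j′ i′)) *F y (Fin.suc (combine j′ i′))))
        ≡⟨ ΣF-cong (λ j′ → trans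
             (ΣF-cong (λ i′ → trans (cong (_*F y (Fin.suc (combine j′ i′))) (Block-entry j j′ i i′)) (*F-assoc (e j j′) (A i i′) _)))
             (ΣF-*ˡ (e j j′) (λ i′ → A i i′ *F y (Fin.suc (combine j′ i′))))) ⟩
      -- Off-diagonal blocks carry the factor 0, so the sum over blocks is a dot product with `e j`
      -- and selects block j.
      dot (e j) (λ j′ → dot (A i) (λ i′ → y (Fin.suc (combine j′ i′))))
        ≡⟨ dot-e j (λ j′ → dot (A i) (λ i′ → y (Fin.suc (combine j′ i′)))) ⟩
      dot (A i) (λ i′ → y (Fin.suc (combine j i′))) ∎)

  e-combine : ∀ {l n} (j j′ : Fin l) (i i′ : Fin n) → e j j′ *F e i i′ ≡ e (Fin.suc (combine j i)) (Fin.suc (combine j′ i′))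
  e-combine j j′ i i′ = by-cases (j Finₚ.≟ j′) (i Finₚ.≟ i′)
    where
      off : ¬ (j ≡ j′ × i ≡ i′) → 0F ≡ e (Fin.suc (combine j i)) (Fin.suc (combine j′ i′))
      off h = sym (e-off-diagonal (h ∘ Finₚ.combine-injective j i j′ i′ ∘ Finₚ.suc-injective))
      by-cases : Dec (j ≡ j′) → Dec (i ≡ i′) → e j j′ *F e i i′ ≡ e (Fin.suc (combine j i)) (Fin.suc (combine j′ i′))
      by-cases (no j≢j′) _ = trans (trans (cong (_*F e i i′) (e-off-diagonal j≢j′)) (FR.zeroˡ (e i i′))) (off (j≢j′ ∘ proj₁))
      by-cases (yes _) (no i≢i′) = trans (trans (cong (e j j′ *F_) (e-off-diagonal i≢i′)) (FR.zeroʳ (e j j′))) (off (i≢i′ ∘ proj₂))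
      by-cases (yes refl) (yes refl) = trans (cong₂ _*F_ (e-diagonal j) (e-diagonal i))
        (trans (*F-identityˡ 1F) (sym (e-diagonal (Fin.suc (combine j i)))))

  -- The columns of the product are images under `_·v_`, so `Block-·v` computes every entry. The
  -- condition c + A d = 0 is the vanishing of the column below the corner; the lemma serves for
  -- both sides of the inverse.
  Block-·m : ∀ l {n} (c d : Vec n) (A B : Mat n) → (∀ i j → (A ·m B) i j ≡ Id i j) →
             (∀ i → c i +F dot (A i) d ≡ 0F) → ∀ q r → (Block l c A ·m Block l d B) q r ≡ Id q r
  Block-·m l c d A B AB≡1 c+Ad≡0 Fin.zero Fin.zero = Block-·v-zero l c A (λ s → Block l d B s Fin.zero)
  Block-·m l c d A B AB≡1 c+Ad≡0 Fin.zero (Fin.suc r) = Block-·v-zero l c A (λ s → Block l d B s (Fin.suc r))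
  Block-·m l c d A B AB≡1 c+Ad≡0 (Fin.suc q) Fin.zero =
    combine-elim l (λ q → (Block l c A ·m Block l d B) (Fin.suc q) Fin.zero ≡ 0F) (λ j i → begin
      (Block l c A ·m Block l d B) (Fin.suc (combine j i)) Fin.zero   ≡⟨ Block-·v l c A (λ s → Block l d B s Fin.zero) j i ⟩
      (c i *F 1F) +F dot (A i) (λ i′ → Block l d B (Fin.suc (combine j i′)) Fin.zero)
                                                                      ≡⟨ cong₂ _+F_ (FR.*-identityʳ (c i)) (dot-cong {v = A i} (λ _ → refl) (Block-column l d B j)) ⟩
      c i +F dot (A i) d                                              ≡⟨ c+Ad≡0 i ⟩
      0F                                                              ∎) q
  Block-·m l {n} c d A B AB≡1 c+Ad≡0 (Fin.suc q) (Fin.suc r) =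
    combine-elim l (λ q → (Block l c A ·m Block l d B) (Fin.suc q) (Fin.suc r) ≡ Id (Fin.suc q) (Fin.suc r)) (λ j i →
    combine-elim l (λ r → (Block l c A ·m Block l d B) (Fin.suc (combine j i)) (Fin.suc r) ≡ Id (Fin.suc (combine j i)) (Fin.suc r)) (λ j′ i′ → begin
      (Block l c A ·m Block l d B) (Fin.suc (combine j i)) (Fin.suc (combine j′ i′))
        ≡⟨ Block-·v l c A (λ s → Block l d B s (Fin.suc (combine j′ i′))) j i ⟩
      (c i *F 0F) +F dot (A i) (λ k → Block l d B (Fin.suc (combine j k)) (Fin.suc (combine j′ i′)))
        ≡⟨ cong₂ _+F_ (FR.zeroʳ (c i)) (dot-cong {v = A i} (λ _ → refl) (λ k → Block-entry l d B j j′ k i′)) ⟩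
      0F +F dot (A i) (λ k → e j j′ *F B k i′)
        ≡⟨ trans (+F-identityˡ _) (dot-*ˡ (e j j′) (A i) (λ k → B k i′)) ⟩
      e j j′ *F (A ·m B) i i′
        ≡⟨ cong (e j j′ *F_) (AB≡1 i i′) ⟩
      e j j′ *F e i i′
        ≡⟨ e-combine j j′ i i′ ⟩
      Id (Fin.suc (combine j i)) (Fin.suc (combine j′ i′)) ∎) r) q

  ·v-·m-identity : ∀ {n} (A B : Mat n) → (∀ i j → (A ·m B) i j ≡ Id i j) → ∀ c → (A ·v (B ·v c)) ≈ c
  ·v-·m-identity A B AB≡1 c i = begin
    ΣF (λ j → A i j *F ΣF (λ k → B j k *F c k))      ≡⟨ ΣF-cong (λ j → sym (ΣF-*ˡ (A i j) (λ k → B j k *F c k))) ⟩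
    ΣF (λ j → ΣF (λ k → A i j *F (B j k *F c k)))    ≡⟨ ΣF-swap (λ j k → A i j *F (B j k *F c k)) ⟩
    ΣF (λ k → ΣF (λ j → A i j *F (B j k *F c k)))    ≡⟨ ΣF-cong (λ k → trans
                                                          (ΣF-cong (λ j → trans (sym (*F-assoc (A i j) (B j k) (c k))) (*F-comm _ (c k))))
                                                          (trans (ΣF-*ˡ (c k) (λ j → A i j *F B j k)) (*F-comm (c k) _))) ⟩
    ΣF (λ k → (A ·m B) i k *F c k)                   ≡⟨ ΣF-cong (λ k → cong (_*F c k) (AB≡1 i k)) ⟩
    dot (e i) c                                      ≡⟨ dot-e i c ⟩
    c i                                              ∎

  Block-nonsingular : ∀ l {n} (c : Vec n) (A : Mat n) → Nonsingular A → Nonsingular (Block l c A)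
  Block-nonsingular l c A (B , AB≡1 , BA≡1) = Block l d B , Block-·m l c d A B AB≡1 right , Block-·m l d c B A BA≡1 left
    where
      -- The condition c + A d = 0 forces d = -A⁻¹c.
      d = 0v -v (B ·v c)
      right : ∀ i → c i +F dot (A i) d ≡ 0F
      right i = begin
        c i +F dot (A i) d                             ≡⟨ cong (c i +F_) (dot--v (A i) 0v (B ·v c)) ⟩
        c i +F (dot (A i) 0v ⊖ (A ·v (B ·v c)) i)      ≡⟨ cong₂ (λ x y → c i +F (x ⊖ y)) (ΣF-zero (λ j → FR.zeroʳ (A i j))) (·v-·m-identity A B AB≡1 c i) ⟩
        c i +F (0F ⊖ c i)                              ≡⟨ trans (+F-comm (c i) _) (⊖-+-cancel 0F (c i)) ⟩
        0F                                             ∎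
      left : ∀ i → d i +F dot (B i) c ≡ 0F
      left i = ⊖-+-cancel 0F ((B ·v c) i)

  -- Exhaustive search, one coordinate at a time. P must respect `_≈_` because a vector is only
  -- pointwise equal to the one rebuilt from its head and tail.
  dec-∃Vec : ∀ {n} (P : Vec n → Set) → (∀ {v w} → v ≈ w → P v → P w) → (∀ v → Dec (P v)) → Dec (Σ (Vec n) P)
  dec-∃Vec {zero} P resp P? = map′ (λ h → empty , h) (λ (v , h) → resp (λ ()) h) (P? empty)
    where
      empty : Vec zero
      empty ()
  dec-∃Vec {suc n} P resp P? = map′ (λ (a , v , h) → (a ◂ v) , h) (λ (v , h) → v Fin.zero , v ∘ Fin.suc , resp (≈-sym (◂-η v)) h)
    (any? (λ a → dec-∃Vec (λ v → P (a ◂ v)) (λ v≈w → resp (◂-cong a v≈w)) (λ v → P? (a ◂ v))))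

  -- Inverses in 𝔽ₚ and the decomposition of δ₀ into hyperplane indicators.

  module _ (p-prime : Prime p) (1<p : 1 < p) where

    1F≢0F : 1F ≢ 0F
    1F≢0F eq = case trans (sym (DM.m<n⇒m%n≡m 1<p)) (trans (sym (toℕ-[] 1)) (trans (cong toℕ eq) (trans (toℕ-[] 0) (DM.m*n%n≡0 0 p)))) of λ ()

    toℕ≡0⇒0F : ∀ {a : F} → toℕ a ≡ 0 → a ≡ 0F
    toℕ≡0⇒0F {a} eq = trans (sym ([toℕ] a)) (cong [_] eq)

    inverse : ∀ (a : F) → a ≢ 0F → Σ F λ b → a *F b ≡ 1F
    inverse a a≢0 with coprime-Bézout (prime⇒coprime p-prime {{ℕ.≢-nonZero (a≢0 ∘ toℕ≡0⇒0F)}} (toℕ<n a))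
    ... | Bézout.+- x y eq = -F [ y ] , (begin
      a *F (-F [ y ])       ≡⟨ sym (-‿distribʳ-* a [ y ]) ⟩
      -F (a *F [ y ])       ≡⟨ sym (+-inverseˡ-unique 1F (a *F [ y ]) 1+ay≡0) ⟩
      1F                    ∎)
      where
        1+ay≡0 : 1F +F (a *F [ y ]) ≡ 0F
        1+ay≡0 = begin
          1F +F (a *F [ y ])           ≡⟨ cong (1F +F_) (trans (*F-comm a [ y ]) (cong ([ y ] *F_) (sym ([toℕ] a)))) ⟩
          1F +F ([ y ] *F [ toℕ a ])   ≡⟨ cong (1F +F_) (sym ([]-* y (toℕ a))) ⟩
          1F +F [ y ℕ.* toℕ a ]        ≡⟨ sym ([]-+ 1 (y ℕ.* toℕ a)) ⟩
          [ 1 ℕ.+ y ℕ.* toℕ a ]        ≡⟨ cong [_] eq ⟩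
          [ x ℕ.* p ]                  ≡⟨ []-cong (trans (DM.m*n%n≡0 x p) (sym (DM.m*n%n≡0 0 p))) ⟩
          0F                           ∎
    ... | Bézout.-+ x y eq = [ y ] , (begin
      a *F [ y ]                ≡⟨ trans (*F-comm a [ y ]) (cong ([ y ] *F_) (sym ([toℕ] a))) ⟩
      [ y ] *F [ toℕ a ]        ≡⟨ sym ([]-* y (toℕ a)) ⟩
      [ y ℕ.* toℕ a ]           ≡⟨ cong [_] (sym eq) ⟩
      [ 1 ℕ.+ x ℕ.* p ]         ≡⟨ []-cong (DM.[m+kn]%n≡m%n 1 x p) ⟩
      1F                        ∎)

    ∃-nonzero : ∀ {n} (w : Vec n) → ¬ (0v ≈ w) → Σ (Fin n) λ i → w i ≢ 0F
    ∃-nonzero {n} w w≉0 with Finₚ.¬∀⟶∃¬ n (λ i → 0F ≡ w i) (λ i → 0F Finₚ.≟ w i) w≉0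
    ... | i , wᵢ≢0 = i , wᵢ≢0 ∘ sym

    -- This is pⁿ⁺¹ - pⁿ, the excess at w = 0 of p times the number of x orthogonal to w over its
    -- value at any other w.
    K : ℕ → ℤ
    K n = + (ℕ.pred p ℕ.* p ℕ.^ n)

    K-nonZero : ∀ n → ℤ.NonZero (K n)
    K-nonZero n = ℕₚ.m*n≢0 (ℕ.pred p) (p ℕ.^ n) {{ℕ.>-nonZero (ℕₚ.pred-mono-≤ 1<p)}} {{ℕₚ.m^n≢0 p n}}

    -- Double counting: the number of x orthogonal to w is pⁿ if w = 0 and pⁿ⁻¹ otherwise.
    δ-average : ∀ {n} (w : Vec n) → + p ℤ.* Σv (λ x → δF (dot x w)) ≡ + (p ℕ.^ n) ℤ.+ K n ℤ.* 1R w
    δ-average {n} w with 0v ≈? w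
    ... | yes 0≈w = begin
      + p ℤ.* Σv (λ x → δF (dot x w))                    ≡⟨ cong (+ p ℤ.*_) (trans (ΣL-cong (allVecs n) (λ x → δF-hit (ΣF-zero λ j →
                                                              trans (cong (x j *F_) (sym (0≈w j))) (FR.zeroʳ (x j))))) (Σv-1 n)) ⟩
      + p ℤ.* + (p ℕ.^ n)                                ≡⟨ sym (ℤₚ.pos-* p (p ℕ.^ n)) ⟩
      + (p ℕ.* p ℕ.^ n)                                  ≡⟨ cong (λ q → + (q ℕ.* p ℕ.^ n)) (sym (ℕₚ.suc-pred p)) ⟩
      + (p ℕ.^ n ℕ.+ ℕ.pred p ℕ.* p ℕ.^ n)               ≡⟨ ℤₚ.pos-+ (p ℕ.^ n) (ℕ.pred p ℕ.* p ℕ.^ n) ⟩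
      + (p ℕ.^ n) ℤ.+ K n                                ≡⟨ cong₂ ℤ._+_ (refl {x = + (p ℕ.^ n)}) (sym (trans (cong (K n ℤ.*_) (g^-hit 0≈w)) (ℤₚ.*-identityʳ (K n)))) ⟩
      + (p ℕ.^ n) ℤ.+ K n ℤ.* 1R w                       ∎
    ... | no 0≉w with ∃-nonzero w 0≉w
    ... | i , wᵢ≢0 with inverse (w i) wᵢ≢0
    ... | b , wᵢb≡1 = begin
      + p ℤ.* Σv (λ x → δF (dot x w))                            ≡⟨ sym (ΣL-tabulate-const {m = p} _ id) ⟩
      -- Translating x by `u t` does not change the count but replaces the condition x·w = 0 by x·w
      -- = t. Over all t, each x is then counted exactly once.
      ΣL (λ t → Σv (λ x → δF (dot x w))) (allFin p)              ≡⟨ ΣL-cong (allFin p) (λ t → trans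
                                                                      (sym (Σv-shift (u t) (λ x → δF (dot x w)) (λ h → cong δF (dot-cong h (λ _ → refl)))))
                                                                      (ΣL-cong (allVecs n) (λ x → cong δF (dot-shift x t)))) ⟩
      ΣL (λ t → Σv (λ x → δF (dot w x ⊖ t))) (allFin p)          ≡⟨ ΣL-swap (λ t x → δF (dot w x ⊖ t)) (allFin p) (allVecs n) ⟩
      Σv (λ x → ΣL (λ t → δF (dot w x ⊖ t)) (allFin p))          ≡⟨ ΣL-cong (allVecs n) (λ x → trans
                                                                      (ΣL-tabulate-single (λ t → δF (dot w x ⊖ t)) id (dot w x)
                                                                        (λ t t≢ → δF-miss (t≢ ∘ sym ∘ ⊖-zero⇒≡)))
                                                                      (δF-hit (-F-inverseʳ (dot w x)))) ⟩
      Σv {n} (λ _ → + 1)                                         ≡⟨ Σv-1 n ⟩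
      + (p ℕ.^ n)                                                ≡⟨ sym (trans (cong₂ ℤ._+_ (refl {x = + (p ℕ.^ n)}) (trans (cong (K n ℤ.*_) (g^-miss 0≉w)) (ℤₚ.*-zeroʳ (K n)))) (ℤₚ.+-identityʳ (+ (p ℕ.^ n)))) ⟩
      + (p ℕ.^ n) ℤ.+ K n ℤ.* 1R w                               ∎
      where
        -- A multiple of one basis vector, scaled by the inverse b of `w i` so that w·`u t` = t.
        u : F → Vec n
        u t j = t *F (b *F e i j)
        dot-shift : ∀ x t → dot (x -v u t) w ≡ dot w x ⊖ t
        dot-shift x t = begin
          dot (x -v u t) w             ≡⟨ dot-comm (x -v u t) w ⟩
          dot w (x -v u t)             ≡⟨ dot--v w x (u t) ⟩
          dot w x ⊖ dot w (u t)        ≡⟨ cong (dot w x ⊖_) (begin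
            dot w (u t)                  ≡⟨ dot-*ˡ t w (λ j → b *F e i j) ⟩
            t *F dot w (λ j → b *F e i j) ≡⟨ cong (t *F_) (dot-*ˡ b w (e i)) ⟩
            t *F (b *F dot w (e i))      ≡⟨ cong (λ s → t *F (b *F s)) (trans (dot-comm w (e i)) (dot-e i w)) ⟩
            t *F (b *F w i)              ≡⟨ cong (t *F_) (trans (*F-comm b (w i)) wᵢb≡1) ⟩
            t *F 1F                      ≡⟨ FR.*-identityʳ t ⟩
            t                            ∎) ⟩
          dot w x ⊖ t                  ∎

    -- By `δ-average`, K·δ₀ is p times the sum of the hyperplane indicators minus the constant pⁿ. A
    -- nonempty family of differences removes the constant, and what remains splits over x.
    Δs-spectral : ∀ {n m} (f : Fin m → Vec n) → 0 < m → ∀ w →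
                  K n ℤ.* V.Δs f 1R w ≡ + p ℤ.* Σv (λ x → V.Δs f (δF ∘ dot x) w)
    Δs-spectral {n} f 0<m w = begin
      K n ℤ.* V.Δs f 1R w                                          ≡⟨ sym (V.Δs-*ˡ f (K n) 1R w) ⟩
      V.Δs f (λ u → K n ℤ.* 1R u) w                                ≡⟨ V.Δs-cong f (λ u → trans (isolate _ (+ (p ℕ.^ n))) (cong (_− + (p ℕ.^ n)) (sym (δ-average u)))) w ⟩
      V.Δs f (λ u → pT u − + (p ℕ.^ n)) w                          ≡⟨ V.Δs-− f pT _ w ⟩
      V.Δs f pT w − V.Δs f (λ _ → + (p ℕ.^ n)) w                   ≡⟨ cong (V.Δs f pT w −_) (V.Δs-const f 0<m (+ (p ℕ.^ n)) w) ⟩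
      V.Δs f pT w − + 0                                            ≡⟨ ℤₚ.+-identityʳ _ ⟩
      V.Δs f pT w                                                  ≡⟨ V.Δs-*ˡ f (+ p) _ w ⟩
      + p ℤ.* V.Δs f (λ u → Σv (λ x → δF (dot x u))) w             ≡⟨ cong (+ p ℤ.*_) (V.Δs-ΣL f (λ x u → δF (dot x u)) (allVecs n) w) ⟩
      + p ℤ.* Σv (λ x → V.Δs f (δF ∘ dot x) w)                     ∎
      where
        pT : Vec n → ℤ
        pT u = + p ℤ.* Σv (λ x → δF (dot x u))
        isolate : ∀ a c → a ≡ (c ℤ.+ a) ℤ.+ (ℤ.- c)
        isolate = solve-∀

    -- By the spectral identity it is enough that both sides have the same contribution from every
    -- x. Either a common factor kills both contributions, or each family has a vector orthogonal to
    -- x, or all steps x·v coincide.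
    Δs-agree : ∀ {n m l} (a : Fin l → Vec n) (f g : Fin m → Vec n) → 0 < m →
               (∀ x → (∃ λ i → dot x (a i) ≡ 0F)
                    ⊎ (∃ λ i → dot x (f i) ≡ 0F × dot x (g i) ≡ 0F)
                    ⊎ (∀ i → dot x (f i) ≡ dot x (g i))) →
               ∀ w → V.Δs a (V.Δs f 1R) w ≡ V.Δs a (V.Δs g 1R) w
    Δs-agree {n} {m} a f g 0<m cases w =
      -- The factor K is divisible by p when n > 0, so this cancellation is available over ℤ and not
      -- modulo p.
      ℤₚ.*-cancelˡ-≡ (K n) _ _ {{K-nonZero n}} (trans (spectral f) (trans
        (cong (+ p ℤ.*_) (ΣL-cong (allVecs n) agree)) (sym (spectral g))))
      where
        spectral : ∀ f → K n ℤ.* V.Δs a (V.Δs f 1R) w ≡ + p ℤ.* Σv (λ x → V.Δs a (V.Δs f (δF ∘ dot x)) w)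
        spectral f = begin
          K n ℤ.* V.Δs a (V.Δs f 1R) w                                    ≡⟨ sym (V.Δs-*ˡ a (K n) (V.Δs f 1R) w) ⟩
          V.Δs a (λ u → K n ℤ.* V.Δs f 1R u) w                            ≡⟨ V.Δs-cong a (Δs-spectral f 0<m) w ⟩
          V.Δs a (λ u → + p ℤ.* Σv (λ x → V.Δs f (δF ∘ dot x) u)) w       ≡⟨ V.Δs-*ˡ a (+ p) _ w ⟩
          + p ℤ.* V.Δs a (λ u → Σv (λ x → V.Δs f (δF ∘ dot x) u)) w       ≡⟨ cong (+ p ℤ.*_) (V.Δs-ΣL a (λ x u → V.Δs f (δF ∘ dot x) u) (allVecs n) w) ⟩
          + p ℤ.* Σv (λ x → V.Δs a (V.Δs f (δF ∘ dot x)) w)               ∎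
        line : ∀ (f : Fin m → Vec n) x → V.Δs a (V.Δs f (δF ∘ dot x)) w ≡ S.Δs (dot x ∘ a) (S.Δs (dot x ∘ f) δF) (dot x w)
        line f x = trans (V.Δs-cong a (Δs-dot f x δF) w) (Δs-dot a x (S.Δs (dot x ∘ f) δF) w)
        agree : ∀ x → V.Δs a (V.Δs f (δF ∘ dot x)) w ≡ V.Δs a (V.Δs g (δF ∘ dot x)) w
        agree x = trans (line f x) (trans (on-line (cases x)) (sym (line g x)))
          where
            on-line : _ → S.Δs (dot x ∘ a) (S.Δs (dot x ∘ f) δF) (dot x w) ≡ S.Δs (dot x ∘ a) (S.Δs (dot x ∘ g) δF) (dot x w)
            on-line (inj₁ (i , eq)) = trans (S-Δs-vanish (dot x ∘ a) i eq _ _) (sym (S-Δs-vanish (dot x ∘ a) i eq _ _))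
            on-line (inj₂ (inj₁ (i , eqf , eqg))) = S.Δs-cong (dot x ∘ a)
              (λ t → trans (S-Δs-vanish (dot x ∘ f) i eqf _ t) (sym (S-Δs-vanish (dot x ∘ g) i eqg _ t))) (dot x w)
            on-line (inj₂ (inj₂ eq)) = S.Δs-cong (dot x ∘ a) (S-Δs-congᶠ eq δF) (dot x w)

    -- Each step by c lowers ψ by κ. After p steps the walk is back at its start, so pκ = 0 and
    -- hence κ = 0 in ℤ; since c is invertible, the walk reaches every element.
    Δ-const⇒const : ∀ {c κ ψ} → c ≢ 0F → (∀ t → S.Δ c ψ t ≡ κ) → ∀ s t → ψ s ≡ ψ t
    Δ-const⇒const {c} {κ} {ψ} c≢0 const s t with inverse c c≢0
    ... | b , cb≡1 = sym (begin
      ψ t                      ≡⟨ cong ψ (sym reach) ⟩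
      ψ (s ⊖ ([ k ] *F c))     ≡⟨ walk s k ⟩
      ψ s − + k ℤ.* κ          ≡⟨ cong (λ z → ψ s − + k ℤ.* z) κ≡0 ⟩
      ψ s − + k ℤ.* + 0        ≡⟨ cong (ψ s −_) (ℤₚ.*-zeroʳ (+ k)) ⟩
      ψ s − + 0                ≡⟨ ℤₚ.+-identityʳ (ψ s) ⟩
      ψ s                      ∎)
      where
        step : ∀ r → ψ (r ⊖ c) ≡ ψ r − κ
        step r = trans (−-self-difference (ψ r) (ψ (r ⊖ c))) (cong (ψ r −_) (const r))
        walk : ∀ r k → ψ (r ⊖ ([ k ] *F c)) ≡ ψ r − + k ℤ.* κ
        walk r zero = trans (cong ψ (trans (cong (r ⊖_) (FR.zeroˡ c)) (⊖-identityʳ r)))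
          (sym (trans (cong (ψ r −_) (ℤₚ.*-zeroˡ κ)) (ℤₚ.+-identityʳ (ψ r))))
        walk r (suc k) = begin
          ψ (r ⊖ ([ suc k ] *F c))             ≡⟨ cong (λ s → ψ (r ⊖ s)) (trans (cong (_*F c) (trans ([]-+ 1 k) (+F-comm 1F [ k ])))
                                                     (trans (FR.distribʳ c [ k ] 1F) (cong (([ k ] *F c) +F_) (*F-identityˡ c)))) ⟩
          ψ (r ⊖ (([ k ] *F c) +F c))          ≡⟨ cong ψ (sym (⊖-assoc r ([ k ] *F c) c)) ⟩
          ψ ((r ⊖ ([ k ] *F c)) ⊖ c)           ≡⟨ step _ ⟩
          ψ (r ⊖ ([ k ] *F c)) − κ             ≡⟨ cong (_− κ) (walk r k) ⟩
          (ψ r − + k ℤ.* κ) − κ                ≡⟨ collect (ψ r) (+ k) κ ⟩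
          ψ r − (+ 1 ℤ.+ + k) ℤ.* κ            ∎
          where
            collect : ∀ a b c → (a ℤ.+ (ℤ.- (b ℤ.* c))) ℤ.+ (ℤ.- c) ≡ a ℤ.+ (ℤ.- ((+ 1 ℤ.+ b) ℤ.* c))
            collect = solve-∀
        pκ≡0 : + p ℤ.* κ ≡ + 0
        pκ≡0 = begin
          + p ℤ.* κ                              ≡⟨ −-self-difference (ψ s) _ ⟩
          ψ s − (ψ s − + p ℤ.* κ)                ≡⟨ cong (ψ s −_) (sym (walk s p)) ⟩
          ψ s − ψ (s ⊖ ([ p ] *F c))             ≡⟨ cong (λ r → ψ s − ψ r) (trans (cong (s ⊖_) (trans (cong (_*F c) [p]≡0) (FR.zeroˡ c))) (⊖-identityʳ s)) ⟩
          ψ s − ψ s                              ≡⟨ ℤₚ.+-inverseʳ (ψ s) ⟩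
          + 0                                    ∎
        κ≡0 : κ ≡ + 0
        κ≡0 with ℤₚ.i*j≡0⇒i≡0∨j≡0 (+ p) pκ≡0
        ... | inj₁ p≡0 = ⊥-elim (ℕ.≢-nonZero⁻¹ p (ℤₚ.+-injective p≡0))
        ... | inj₂ eq = eq
        k : ℕ
        k = toℕ ((s ⊖ t) *F b)
        reach : s ⊖ ([ k ] *F c) ≡ t
        reach = begin
          s ⊖ ([ k ] *F c)               ≡⟨ cong (λ r → s ⊖ (r *F c)) ([toℕ] ((s ⊖ t) *F b)) ⟩
          s ⊖ (((s ⊖ t) *F b) *F c)      ≡⟨ cong (s ⊖_) (trans (*F-assoc (s ⊖ t) b c) (cong ((s ⊖ t) *F_) (trans (*F-comm b c) cb≡1))) ⟩
          s ⊖ ((s ⊖ t) *F 1F)            ≡⟨ cong (s ⊖_) (FR.*-identityʳ (s ⊖ t)) ⟩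
          s ⊖ (s ⊖ t)                    ≡⟨ ⊖-self-difference s t ⟩
          t                              ∎

    Δs-const⇒const : ∀ {m} (c : Fin m → F) → (∀ i → c i ≢ 0F) → ∀ {ψ} →
                     (∀ s t → S.Δs c ψ s ≡ S.Δs c ψ t) → ∀ s t → ψ s ≡ ψ t
    Δs-const⇒const {zero} c c≢0 const = const
    Δs-const⇒const {suc m} c c≢0 const =
      Δs-const⇒const (c ∘ Fin.suc) (c≢0 ∘ Fin.suc) (Δ-const⇒const (c≢0 Fin.zero) (λ t → const t 0F))

    -- If the product vanished, so would its action on the hyperplane indicator of x. There all
    -- steps are nonzero, and peeling off one difference at a time would make δ on 𝔽ₚ constant,
    -- although it separates 0 from 1.
    Δs-nonvanishing : ∀ {n m l} (f : Fin (suc m) → Vec n) (g : Fin l → Vec n) (x : Vec n) →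
                      (∀ i → dot x (f i) ≢ 0F) → (∀ i → dot x (g i) ≢ 0F) → ¬ IsZero (V.Δs f (V.Δs g 1R))
    Δs-nonvanishing f g x f≢0 g≢0 zeros with inverse (dot x (f Fin.zero)) (f≢0 Fin.zero)
    ... | b , xf₀b≡1 = case trans (sym (δF-hit refl)) (trans (δF-const 0F 1F) (δF-miss 1F≢0F)) of λ ()
      where
        on-line : ∀ t → S.Δs (dot x ∘ f) (S.Δs (dot x ∘ g) δF) t ≡ + 0
        on-line t = begin
          S.Δs (dot x ∘ f) (S.Δs (dot x ∘ g) δF) t           ≡⟨ cong (S.Δs (dot x ∘ f) (S.Δs (dot x ∘ g) δF)) (sym reach) ⟩
          S.Δs (dot x ∘ f) (S.Δs (dot x ∘ g) δF) (dot x w)   ≡⟨ sym (trans (V.Δs-cong f (Δs-dot g x δF) w) (Δs-dot f x _ w)) ⟩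
          V.Δs f (V.Δs g (δF ∘ dot x)) w                     ≡⟨ Δs-vanish-all f g zeros (δF ∘ dot x) (λ h → cong δF (dot-cong {v = x} (λ _ → refl) h)) w ⟩
          + 0                                                ∎
          where
            -- A multiple of the first vector of f, which is not orthogonal to x, scaled so that x·w
            -- takes the prescribed value t.
            w = λ j → (t *F b) *F f Fin.zero j
            reach : dot x w ≡ t
            reach = begin
              dot x w                           ≡⟨ dot-*ˡ (t *F b) x (f Fin.zero) ⟩
              (t *F b) *F dot x (f Fin.zero)    ≡⟨ *F-assoc t b _ ⟩
              t *F (b *F dot x (f Fin.zero))    ≡⟨ cong (t *F_) (trans (*F-comm b _) xf₀b≡1) ⟩
              t *F 1F                           ≡⟨ FR.*-identityʳ t ⟩
              t                                 ∎
        δF-const : ∀ s t → δF s ≡ δF t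
        δF-const = Δs-const⇒const (dot x ∘ g) g≢0
          (Δs-const⇒const (dot x ∘ f) f≢0 (λ s t → trans (on-line s) (sym (on-line t))))

    -- By absorption p divides k·`β p k`, and it does not divide k because 0 < k < p; Euclid's lemma
    -- leaves the coefficient.
    p∣β : ∀ k → 0 < k → k < p → + p ℤ∣.∣ β p k
    p∣β (suc k) _ k<p with euclidsLemma (suc k) ℤ.∣ β p (suc k) ∣ p-prime
        (subst (p ℕ∣.∣_) (ℤₚ.abs-* (+ suc k) (β p (suc k))) (ℤ∣.∣⇒∣ᵤ p∣[1+k]β))
      where
        p∣[1+k]β : + p ℤ∣.∣ + suc k ℤ.* β p (suc k)
        p∣[1+k]β = subst (λ q → + q ℤ∣.∣ + suc k ℤ.* β q (suc k)) (ℕₚ.suc-pred p)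
          (subst (+ suc (ℕ.pred p) ℤ∣.∣_) (sym (β-absorb (ℕ.pred p) k))
            (ℤ∣.∣m⇒∣-m (ℤ∣.∣m⇒∣m*n (β (ℕ.pred p) k) ℤ∣.∣-refl)))
    ... | inj₁ p∣1+k = ⊥-elim (ℕ∣.>⇒∤ k<p p∣1+k)
    ... | inj₂ p∣β = ℤ∣.∣ᵤ⇒∣ p∣β

    -- Subtracting the constant φ w kills the two terms of the binomial expansion whose coefficients are ±1.
    Nil-p : ∀ {n} (z : Vec n) {φ} → Ext φ → Nil z p φ
    Nil-p {n} z {φ} ext .p∣Δᵏ w = subst (+ p ℤ∣.∣_) (sym expansion)
      (ΣN-∣ (+ p) (suc p ℕ.+ 0) _ (λ k k< → term k (subst (k ≤_) (ℕₚ.+-identityʳ p) (ℕₚ.≤-pred k<))))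
      where
        φ′ : Vec n → ℤ
        φ′ v = φ v − φ w
        u : ℕ → Vec n
        u j = w -v (λ i → [ j ] *F z i)
        step : ∀ j → u (suc j) ≈ (u j -v z)
        step j i = trans (cong (w i ⊖_) (begin
            [ suc j ] *F z i               ≡⟨ cong (_*F z i) (trans ([]-+ 1 j) (+F-comm 1F [ j ])) ⟩
            ([ j ] +F 1F) *F z i           ≡⟨ FR.distribʳ (z i) [ j ] 1F ⟩
            ([ j ] *F z i) +F (1F *F z i)  ≡⟨ cong (([ j ] *F z i) +F_) (*F-identityˡ (z i)) ⟩
            ([ j ] *F z i) +F z i          ∎))
          (sym (⊖-assoc (w i) ([ j ] *F z i) (z i)))
        ext′ : Ext φ′
        ext′ h = cong (_− φ w) (ext h)
        u≈w : ∀ {j} → [ j ] ≡ 0F → u j ≈ w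
        u≈w eq i = trans (cong (w i ⊖_) (trans (cong (_*F z i) eq) (FR.zeroˡ (z i)))) (⊖-identityʳ (w i))
        φ′-zero : ∀ {j} → [ j ] ≡ 0F → φ′ (u j) ≡ + 0
        φ′-zero eq = trans (cong (_− φ w) (ext (u≈w eq))) (ℤₚ.+-inverseʳ (φ w))
        expansion : V.Δs {m = p} (λ _ → z) φ w ≡ ΣN (suc p ℕ.+ 0) (λ k → β p k ℤ.* φ′ (u k))
        expansion = begin
          Δp φ w                                ≡⟨ sym (ℤₚ.+-identityʳ _) ⟩
          Δp φ w − + 0                          ≡⟨ cong (Δp φ w −_) (sym (V.Δs-const (λ _ → z) (ℕₚ.<-trans (s≤s z≤n) 1<p) (φ w) w)) ⟩
          Δp φ w − Δp (λ _ → φ w) w             ≡⟨ sym (V.Δs-− {m = p} (λ _ → z) φ (λ _ → φ w) w) ⟩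
          Δp φ′ w                               ≡⟨ Δs-ext {m = p} (λ _ → z) ext′ (≈-sym (u≈w refl)) ⟩
          Δp φ′ (u 0)                           ≡⟨ Δs-binomial z ext′ u step p 0 0 ⟩
          ΣN (suc p ℕ.+ 0) (λ k → β p k ℤ.* φ′ (u k))  ∎
          where Δp = V.Δs {m = p} (λ _ → z)
        vanishing : ∀ k → φ′ (u k) ≡ + 0 → + p ℤ∣.∣ β p k ℤ.* φ′ (u k)
        vanishing k eq = subst (+ p ℤ∣.∣_) (sym (trans (cong (β p k ℤ.*_) eq) (ℤₚ.*-zeroʳ (β p k)))) (∣-zero (+ p))
        term : ∀ k → k ≤ p → + p ℤ∣.∣ β p k ℤ.* φ′ (u k)
        term zero k≤p = vanishing 0 (φ′-zero refl)
        term (suc k) k≤p with suc k ℕₚ.≟ p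
        ... | yes 1+k≡p = vanishing (suc k) (φ′-zero (trans (cong [_] 1+k≡p) [p]≡0))
        ... | no 1+k≢p = ℤ∣.∣m⇒∣m*n (φ′ (u (suc k))) (p∣β (suc k) (s≤s z≤n) (ℕₚ.≤∧≢⇒< k≤p 1+k≢p))

    -- The contradiction from a row that is forced to vanish.

    module _ {n} (M : Mat n) (x₀ : Vec n) (x₀≢0 : ∀ i → x₀ i ≢ 0F) (i₀ : Fin n)
             (forced : ∀ x → (∀ i → x i ≢ 0F) → (∀ i → (M ·v x₀) i ≢ 0F → (M ·v x) i ≢ 0F) → (M ·v x) i₀ ≡ 0F) where

      Mx₀-i₀ : (M ·v x₀) i₀ ≡ 0F
      Mx₀-i₀ = forced x₀ x₀≢0 (λ _ → id)

      -- The indicator of the complement of I: z enters precisely the rows of M that vanish at x₀.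
      c : Vec n
      c i = if does ((M ·v x₀) i Finₚ.≟ 0F) then 1F else 0F

      c-1 : ∀ {i} → (M ·v x₀) i ≡ 0F → c i ≡ 1F
      c-1 {i} eq = cong (λ b → if b then 1F else 0F) (dec-true ((M ·v x₀) i Finₚ.≟ 0F) eq)

      c-0 : ∀ {i} → (M ·v x₀) i ≢ 0F → c i ≡ 0F
      c-0 {i} neq = cong (λ b → if b then 1F else 0F) (dec-false ((M ·v x₀) i Finₚ.≟ 0F) neq)

      M′ : Mat (suc (p ℕ.* n))
      M′ = Block p c M

      x′ : Vec (suc (p ℕ.* n))
      x′ Fin.zero = 1F
      x′ (Fin.suc q) = x₀ (proj₂ (remQuot {p} n q))

      x′≢0 : ∀ q → x′ q ≢ 0F
      x′≢0 Fin.zero = 1F≢0F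
      x′≢0 (Fin.suc q) = x₀≢0 _

      -- In every row exactly one of the two summands is nonzero: the 1 contributed by z where M x₀
      -- vanishes, and the entry of M x₀ elsewhere.
      M′x′≢0 : ∀ q → (M′ ·v x′) q ≢ 0F
      M′x′≢0 Fin.zero eq = 1F≢0F (trans (sym (Block-·v-zero p c M x′)) eq)
      M′x′≢0 (Fin.suc q) = combine-elim p (λ q → (M′ ·v x′) (Fin.suc q) ≢ 0F) (λ j i eq →
          nonzero i (trans (sym (trans (Block-·v p c M x′ j i)
            (cong₂ _+F_ (FR.*-identityʳ (c i)) (dot-cong {v = M i} (λ _ → refl) (λ i′ → cong (x₀ ∘ proj₂) (Finₚ.remQuot-combine j i′)))))) eq)) q
        where
          nonzero : ∀ i → c i +F (M ·v x₀) i ≢ 0F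
          nonzero i eq with (M ·v x₀) i Finₚ.≟ 0F
          ... | yes Mx₀ᵢ≡0 = 1F≢0F (trans (sym (FR.+-identityʳ 1F)) (trans (cong (1F +F_) (sym Mx₀ᵢ≡0)) eq))
          ... | no Mx₀ᵢ≢0 = Mx₀ᵢ≢0 (trans (sym (+F-identityˡ _)) eq)

      expr-nonzero : ¬ IsZero (expr M′)
      expr-nonzero zeros = Δs-nonvanishing e M′ x′
        (λ i eq → x′≢0 i (trans (sym (dot-e i x′)) (trans (dot-comm (e i) x′) eq)))
        (λ q eq → M′x′≢0 q (trans (dot-comm (M′ q) x′) eq))
        (λ w → trans (sym (expr-Δs M′ w)) (zeros w))

      M″ : Mat (suc (p ℕ.* n))
      M″ Fin.zero = M′ Fin.zero
      M″ (Fin.suc q) = if does (proj₂ (remQuot {p} n q) Finₚ.≟ i₀) then e Fin.zero else M′ (Fin.suc q)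

      M″-hit : ∀ (j : Fin p) → M″ (Fin.suc (combine j i₀)) ≡ e Fin.zero
      M″-hit j = cong (λ b → if b then e Fin.zero else M′ (Fin.suc (combine j i₀)))
        (dec-true (proj₂ (remQuot {p} n (combine j i₀)) Finₚ.≟ i₀) (cong proj₂ (Finₚ.remQuot-combine j i₀)))

      M″-miss : ∀ (j : Fin p) {i} → i ≢ i₀ → M″ (Fin.suc (combine j i)) ≡ M′ (Fin.suc (combine j i))
      M″-miss j {i} i≢i₀ = cong (λ b → if b then e Fin.zero else M′ (Fin.suc (combine j i)))
        (dec-false (proj₂ (remQuot {p} n (combine j i)) Finₚ.≟ i₀) (i≢i₀ ∘ trans (sym (cong proj₂ (Finₚ.remQuot-combine j i)))))

      -- If x has a zero entry, a basis vector is orthogonal to it. Otherwise, if the part of x in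
      -- some copy gives 0 at a row of I, that row carries no z and differs from i₀, so it is
      -- orthogonal to x in both matrices. In the remaining case `forced` applies to the part of x
      -- in every copy, and aᵢ₀ + z has the same product with x as z.
      M′-M″-agree : ∀ x → (∃ λ i → dot x (e i) ≡ 0F)
                        ⊎ (∃ λ q → dot x (M′ q) ≡ 0F × dot x (M″ q) ≡ 0F)
                        ⊎ (∀ q → dot x (M′ q) ≡ dot x (M″ q))
      M′-M″-agree x with any? (λ q → x q Finₚ.≟ 0F)
      ... | yes (q , xq≡0) = inj₁ (q , trans (dot-comm x (e q)) (trans (dot-e q x) xq≡0))
      ... | no x≢0 with any? (λ (j : Fin p) → any? (λ i →
                 ¬? ((M ·v x₀) i Finₚ.≟ 0F) ×-dec ((M ·v (λ i′ → x (Fin.suc (combine j i′)))) i Finₚ.≟ 0F)))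
      ... | yes (j , i , Mx₀ᵢ≢0 , Mxᵢ≡0) = inj₂ (inj₁ (Fin.suc (combine j i) , vanishes ,
              trans (cong (dot x) (M″-miss j (λ { refl → Mx₀ᵢ≢0 Mx₀-i₀ }))) vanishes))
        where
          vanishes : dot x (M′ (Fin.suc (combine j i))) ≡ 0F
          vanishes = begin
            dot x (M′ (Fin.suc (combine j i)))  ≡⟨ trans (dot-comm x (M′ (Fin.suc (combine j i)))) (Block-·v p c M x j i) ⟩
            (c i *F x Fin.zero) +F _            ≡⟨ cong₂ _+F_ (trans (cong (_*F x Fin.zero) (c-0 Mx₀ᵢ≢0)) (FR.zeroˡ (x Fin.zero))) Mxᵢ≡0 ⟩
            0F +F 0F                            ≡⟨ +F-identityˡ 0F ⟩
            0F                                  ∎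
      ... | no none = inj₂ (inj₂ λ { Fin.zero → refl ; (Fin.suc q) → combine-elim p (λ q → dot x (M′ (Fin.suc q)) ≡ dot x (M″ (Fin.suc q))) agree q })
        where
          agree : ∀ (j : Fin p) i → dot x (M′ (Fin.suc (combine j i))) ≡ dot x (M″ (Fin.suc (combine j i)))
          agree j i with i Finₚ.≟ i₀
          ... | no i≢i₀ = cong (dot x) (sym (M″-miss j i≢i₀))
          ... | yes refl = begin
            dot x (M′ (Fin.suc (combine j i₀)))  ≡⟨ trans (dot-comm x (M′ (Fin.suc (combine j i₀)))) (Block-·v p c M x j i₀) ⟩
            (c i₀ *F x Fin.zero) +F (M ·v (λ i′ → x (Fin.suc (combine j i′)))) i₀
              ≡⟨ cong₂ _+F_ (trans (cong (_*F x Fin.zero) (c-1 Mx₀-i₀)) (*F-identityˡ (x Fin.zero)))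
                   (forced (λ i′ → x (Fin.suc (combine j i′))) (λ i′ eq → x≢0 (_ , eq))
                     (λ i′ Mx₀≢0 Mx≡0 → none (j , i′ , Mx₀≢0 , Mx≡0))) ⟩
            x Fin.zero +F 0F                     ≡⟨ FR.+-identityʳ (x Fin.zero) ⟩
            x Fin.zero                           ≡⟨ sym (trans (dot-comm x (e Fin.zero)) (dot-e Fin.zero x)) ⟩
            dot x (e Fin.zero)                   ≡⟨ cong (dot x) (sym (M″-hit j)) ⟩
            dot x (M″ (Fin.suc (combine j i₀)))  ∎

      -- The exchange of M′ for M″ happens over ℤ. `Nil-p` then starts with p owed factors on δ₀,
      -- and the p rows equal to z, one in each copy, pay them all.
      p∣expr : ∀ w → + p ℤ∣.∣ expr M′ w
      p∣expr w = subst (+ p ℤ∣.∣_)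
        (sym (trans (expr-Δs M′ w) (Δs-agree e M′ M″ (s≤s z≤n) M′-M″-agree w)))
        (p∣Δᵏ nil w)
        where
          z : Vec (suc (p ℕ.* n))
          z = e Fin.zero
          ext : Ext (V.Δs (M″ ∘ Fin.suc) 1R)
          ext = Δs-ext (M″ ∘ Fin.suc) 1R-ext
          nil : Nil z 0 (V.Δs e (V.Δs M″ 1R))
          nil = Nil-Δs e (Δ-ext (M″ Fin.zero) ext) (Nil-Δ (M″ Fin.zero) ext
            (Nil-blocks p (M″ ∘ Fin.suc) i₀ (λ j i → cong (λ v → v i) (M″-hit j)) 1R-ext
              (subst (λ k → Nil z k 1R) (sym (ℕₚ.+-identityʳ p)) (Nil-p z 1R-ext))))

      forced-impossible : Hypothesis → Nonsingular M → ⊥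
      forced-impossible hyp nonsing = expr-nonzero (hyp _ (s≤s z≤n) M′ (Block-nonsingular p c M nonsing)
        (λ w → ~-∣⇒0 (≃-expr M′ w) (p∣expr w)))

    -- The choice of x₀ and i₀.

    module _ {n} (M : Mat n) where

      Feasible : ℕ → Vec n → Set
      Feasible t x = (∀ i → x i ≢ 0F) × (∀ i → toℕ i < t → (M ·v x) i ≢ 0F)

      Feasible? : ∀ t → Dec (Σ (Vec n) (Feasible t))
      Feasible? t = dec-∃Vec (Feasible t)
        (λ v≈w (v≢0 , Mv≢0) → (λ i eq → v≢0 i (trans (v≈w i) eq)) ,
                              (λ i i<t eq → Mv≢0 i i<t (trans (dot-cong {v = M i} (λ _ → refl) v≈w) eq)))
        (λ x → all? (λ i → ¬? (x i Finₚ.≟ 0F)) ×-dec all? (λ i → (toℕ i ℕₚ.<? t) →-dec ¬? ((M ·v x) i Finₚ.≟ 0F)))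

      -- Either the first t rows can be made nonzero together, or there is a last feasible prefix
      -- length s below t. Keeping the witness for s together with the refutation for s + 1 is what
      -- makes row s forced.
      search : ∀ t → Σ (Vec n) (Feasible t) ⊎ ∃ λ s → s < t × Σ (Vec n) (Feasible s) × ¬ Σ (Vec n) (Feasible (suc s))
      -- The empty prefix puts no condition on M x, so the all-ones vector serves.
      search zero = inj₁ ((λ _ → 1F) , (λ _ → 1F≢0F) , λ _ ())
      search (suc t) with search t
      ... | inj₂ (s , s<t , found) = inj₂ (s , ℕₚ.m<n⇒m<1+n s<t , found)
      ... | inj₁ found with Feasible? (suc t)
      ... | yes found′ = inj₁ found′
      ... | no none = inj₂ (t , ℕₚ.n<1+n t , found , none)

      conclusion : Hypothesis → Nonsingular M → Σ (Vec n) λ x → (∀ i → x i ≢ 0F) × (∀ i → (M ·v x) i ≢ 0F)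
      conclusion hyp nonsing with search n
      ... | inj₁ (x , x≢0 , Mx≢0) = x , x≢0 , λ i → Mx≢0 i (toℕ<n i)
      ... | inj₂ (s , s<n , (x₀ , x₀≢0 , Mx₀≢0) , none) = ⊥-elim (forced-impossible M x₀ x₀≢0 i₀ forced hyp nonsing)
        where
          i₀ = Fin.fromℕ< s<n
          -- The set I contains the first s rows. An x that keeps M x nonzero on I and also at row s
          -- would be feasible for s + 1.
          forced : ∀ x → (∀ i → x i ≢ 0F) → (∀ i → (M ·v x₀) i ≢ 0F → (M ·v x) i ≢ 0F) → (M ·v x) i₀ ≡ 0F
          forced x x≢0 preserved with (M ·v x) i₀ Finₚ.≟ 0F
          ... | yes eq = eq
          ... | no Mx≢0 = ⊥-elim (none (x , x≢0 , λ i i<1+s → by-cases i (ℕₚ.m≤n⇒m<n∨m≡n (ℕₚ.≤-pred i<1+s))))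
            where
              by-cases : ∀ i → toℕ i < s ⊎ toℕ i ≡ s → (M ·v x) i ≢ 0F
              by-cases i (inj₁ i<s) = preserved i (Mx₀≢0 i i<s)
              by-cases i (inj₂ i≡s) = subst (λ i → (M ·v x) i ≢ 0F)
                (toℕ-injective (trans (toℕ-fromℕ< s<n) (sym i≡s))) Mx≢0

theoremC : (p : ℕ) → {{_ : NonZero p}} → Prime p → 3 < p → Fp.Hypothesis p →
    ∀ n → 1 ≤ n → (M : Fp.Mat p n) → Fp.Nonsingular p M →
    Σ (Fp.Vec p n) λ x → (∀ i → x i ≢ Fp.0F p) × (∀ i → Fp._·v_ p M x i ≢ Fp.0F p)
theoremC p p-prime 3<p hyp n _ M nonsing = conclusion p p-prime (ℕₚ.<-trans (s≤s (s≤s z≤n)) 3<p) M hyp nonsing
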